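{- Let $S_{1,n-3}$ be the tree with vertices $v_0,\dots,v_{n-1}$ and edges $e_1=\{v_0,v_1\}$, $e_2=\{v_1,v_2\}$, $e_i=\{v_2,v_i\}$ for $3\le i\le n-1$. Let $B_1=\{e_1,\dots,e_{n-1},\{v_0,v_2\},\{v_1,v_3\}\}$ and $B_2=\{e_1,\dots,e_{n-1},\{v_0,v_2\},\{v_3,v_4\}\}$. (1) If $a_0,\dots,a_{n+1}$ are the coefficients of $\det(xI-\mathfrak{D}_2(S_{1,n-3})[B_1,B_1])=\sum_{k}a_kx^k$ and $|a_t|=\max_k|a_k|$, then $\lfloor\frac{n-4}{2}\rfloor\le t\le\lceil\frac{n+4}{2}\rceil$. (2) If $b_0,\dots,b_{n+1}$ are the coefficients of $\det(xI-\mathfrak{D}_2(S_{1,n-3})[B_2,B_2])=\sum_k b_kx^k$ and $|b_t|=\max_k|b_k|$, then $\lfloor\frac{n-4}{2}\rfloor\le t\le\lceil\frac{n+4}{2}\rceil$.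
   Context: For a tree $T$, let $\mathcal{V}_2$ be the set of 2-element vertex subsets (edges regarded as elements of $\mathcal{V}_2$). The 2-Steiner distance matrix $\mathfrak{D}_2(T)$ is indexed by $\mathcal{V}_2$, with entry in row $\{i,j\}$, column $\{k,l\}$ equal to the minimum number of edges of a connected subtree of $T$ whose vertex set contains $i,j,k,l$. $M[B,B]$ denotes the principal submatrix with rows and columns indexed by $B$. -}

module Defs where

open import Algebra.Bundles.Raw using (RawRing)
import Algebra.Definitions.RawSemiring as RawSemiringDefs
open import Data.Bool.Base using (if_then_else_)
import Data.Bool.Properties as Bool
open import Data.Empty using (⊥-elim)
open import Data.Fin.Base using (Fin; zero; suc; fromℕ; inject₁; punchIn; toℕ)
open import Data.Fin.Properties using (all?; any?) renaming (_≟_ to _≟ᶠ_)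
open import Data.Fin.Subset using (Subset; _∈_; _⊆_; _∪_; ⁅_⁆; ∣_∣; ⊤)
open import Data.Fin.Subset.Properties using (_∈?_; _⊆?_; anySubset?; x∈⁅x⁆; x∈⁅y⁆⇒x≡y; x∈p∪q⁺; x∈p∪q⁻; ∪-comm; ∪-identityˡ; ∪-identityʳ; ∣⁅x⁆∣≡1; ∈⊤; ⊆⊤)
open import Data.Integer.Base as ℤ using (ℤ; +_)
open import Data.List.Base using (List; []; _∷_; map; allFin)
open import Data.List.Membership.Propositional using () renaming (_∈_ to _∈ˡ_)
open import Data.List.Membership.Propositional.Properties using (∈-allFin)
open import Data.List.Relation.Unary.Any using (here; there)
open import Data.Nat.Base using (ℕ; zero; suc; _+_; _≤_; z≤n; s≤s)
import Data.Nat.Properties as ℕ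
open import Data.Product.Base using (∃; ∃₂; _×_; _,_; proj₁; proj₂)
open import Data.Sum.Base using (_⊎_; inj₁; inj₂)
import Data.Vec.Functional as Vector
open import Data.Vec.Properties using (≡-dec)
open import Function.Base using (_∘_)
open import Level using (0ℓ)
open import Relation.Binary.Construct.Closure.ReflexiveTransitive using (Star; ε; _◅_; _◅◅_; reverse)
import Relation.Binary.Definitions as Rel
open import Relation.Binary.PropositionalEquality using (_≡_; _≢_; refl; sym; trans; cong; subst)
open import Relation.Nullary.Decidable using (Dec; yes; no; does; map′; _×-dec_; _⊎-dec_; _→-dec_)
open import Relation.Nullary.Negation using (¬_)

record V₂ (n : ℕ) : Set where
  constructor mkV₂
  field
    set  : Subset n
    card : ∣ set ∣ ≡ 2

open V₂ public

∣⁅i⁆∪⁅j⁆∣≡2 : ∀ {n} (i j : Fin n) → i ≢ j → ∣ ⁅ i ⁆ ∪ ⁅ j ⁆ ∣ ≡ 2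
∣⁅i⁆∪⁅j⁆∣≡2 zero    zero    i≢j = ⊥-elim (i≢j refl)
∣⁅i⁆∪⁅j⁆∣≡2 zero    (suc j) i≢j = cong suc (trans (cong ∣_∣ (∪-identityˡ ⁅ j ⁆)) (∣⁅x⁆∣≡1 j))
∣⁅i⁆∪⁅j⁆∣≡2 (suc i) zero    i≢j = cong suc (trans (cong ∣_∣ (∪-identityʳ ⁅ i ⁆)) (∣⁅x⁆∣≡1 i))
∣⁅i⁆∪⁅j⁆∣≡2 (suc i) (suc j) i≢j = ∣⁅i⁆∪⁅j⁆∣≡2 i j (i≢j ∘ cong suc)

pair : ∀ {n} (i j : Fin n) → i ≢ j → V₂ n
pair i j i≢j = mkV₂ (⁅ i ⁆ ∪ ⁅ j ⁆) (∣⁅i⁆∪⁅j⁆∣≡2 i j i≢j)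

∈-pair⁻ : ∀ {n} {x : Fin n} i j → x ∈ ⁅ i ⁆ ∪ ⁅ j ⁆ → x ≡ i ⊎ x ≡ j
∈-pair⁻ i j x∈ with x∈p∪q⁻ ⁅ i ⁆ ⁅ j ⁆ x∈
... | inj₁ x∈i = inj₁ (x∈⁅y⁆⇒x≡y i x∈i)
... | inj₂ x∈j = inj₂ (x∈⁅y⁆⇒x≡y j x∈j)

∈-pairˡ : ∀ {n} (i j : Fin n) → i ∈ ⁅ i ⁆ ∪ ⁅ j ⁆
∈-pairˡ i j = x∈p∪q⁺ (inj₁ (x∈⁅x⁆ i))

∈-pairʳ : ∀ {n} (i j : Fin n) → j ∈ ⁅ i ⁆ ∪ ⁅ j ⁆
∈-pairʳ i j = x∈p∪q⁺ (inj₂ (x∈⁅x⁆ j))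

pair-injective : ∀ {n} (i j k l : Fin n) → i ≢ j → ⁅ i ⁆ ∪ ⁅ j ⁆ ≡ ⁅ k ⁆ ∪ ⁅ l ⁆ → (k ≡ i × l ≡ j) ⊎ (k ≡ j × l ≡ i)
pair-injective i j k l i≢j eq
  with ∈-pair⁻ k l (subst (i ∈_) eq (∈-pairˡ i j)) | ∈-pair⁻ k l (subst (j ∈_) eq (∈-pairʳ i j))
... | inj₁ i≡k | inj₁ j≡k = ⊥-elim (i≢j (trans i≡k (sym j≡k)))
... | inj₁ i≡k | inj₂ j≡l = inj₁ (sym i≡k , sym j≡l)
... | inj₂ i≡l | inj₁ j≡k = inj₂ (sym j≡k , sym i≡l)
... | inj₂ i≡l | inj₂ j≡l = ⊥-elim (i≢j (trans i≡l (sym j≡l)))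

-- Vertices are Fin n; the m edges are distinct two-element vertex sets.
record Graph (n m : ℕ) : Set where
  field
    edge     : Fin m → V₂ n
    distinct : ∀ {e f} → set (edge e) ≡ set (edge f) → e ≡ f

module _ {n m : ℕ} (G : Graph n m) where
  open Graph G

  Adjacent : Subset m → Fin n → Fin n → Set
  Adjacent E u v = ∃ λ e → e ∈ E × set (edge e) ≡ ⁅ u ⁆ ∪ ⁅ v ⁆

  IsSubgraph : Subset n → Subset m → Set
  IsSubgraph V E = ∀ e → e ∈ E → set (edge e) ⊆ V

  IsConnected : Subset n → Subset m → Set
  IsConnected V E = ∀ u v → u ∈ V → v ∈ V → Star (Adjacent E) u v

  record Cycle : Set where
    field
      {k}       : ℕ
      vertex    : Fin (3 + k) → Fin n
      injective : ∀ {i j} → vertex i ≡ vertex j → i ≡ j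
      step      : ∀ (i : Fin (2 + k)) → Adjacent ⊤ (vertex (inject₁ i)) (vertex (suc i))
      close     : Adjacent ⊤ (vertex (fromℕ (2 + k))) (vertex zero)

record Tree (n m : ℕ) : Set where
  field
    graph     : Graph n m
    connected : IsConnected graph ⊤ ⊤
    acyclic   : ¬ Cycle graph
  open Graph graph public

-- In a tree every connected subgraph is acyclic, hence a subtree.
IsSubtree : ∀ {n m} → Tree n m → Subset n → Subset m → Set
IsSubtree T V E = IsSubgraph (Tree.graph T) V E × IsConnected (Tree.graph T) V E

SubtreeOfSize : ∀ {n m} → Tree n m → Subset n → ℕ → Set
SubtreeOfSize T p d = ∃₂ λ V E → IsSubtree T V E × p ⊆ V × ∣ E ∣ ≡ d

IsLeast : (ℕ → Set) → ℕ → Set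
IsLeast P d = P d × (∀ j → P j → d ≤ j)

-- The following decision procedure and search turn "the minimum number of
-- edges" into a function; `steiner` carries its characterising property.

module _ {n : ℕ} {R : Fin n → Fin n → Set} (R? : Rel.Decidable R) where

  -- Walks whose intermediate vertices lie in a given list (Warshall).
  Via : List (Fin n) → Fin n → Fin n → Set
  Via []       u v = u ≡ v ⊎ R u v
  Via (w ∷ ws) u v = Via ws u v ⊎ (Via ws u w × Via ws w v)

  via? : ∀ ws → Rel.Decidable (Via ws)
  via? []       u v = (u ≟ᶠ v) ⊎-dec R? u v
  via? (w ∷ ws) u v = via? ws u v ⊎-dec (via? ws u w ×-dec via? ws w v)

  Via⇒Star : ∀ ws {u v} → Via ws u v → Star R u v
  Via⇒Star []       (inj₁ refl)    = ε
  Via⇒Star []       (inj₂ r)       = r ◅ ε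
  Via⇒Star (w ∷ ws) (inj₁ p)       = Via⇒Star ws p
  Via⇒Star (w ∷ ws) (inj₂ (p , q)) = Via⇒Star ws p ◅◅ Via⇒Star ws q

  Via-base : ∀ ws {u v} → u ≡ v ⊎ R u v → Via ws u v
  Via-base []       p = p
  Via-base (w ∷ ws) p = inj₁ (Via-base ws p)

  Via-trans : ∀ ws {u w v} → w ∈ˡ ws → Via ws u w → Via ws w v → Via ws u v
  Via-trans (x ∷ ws) (here refl) (inj₁ p)       (inj₁ q)       = inj₂ (p , q)
  Via-trans (x ∷ ws) (here refl) (inj₁ p)       (inj₂ (_ , q)) = inj₂ (p , q)
  Via-trans (x ∷ ws) (here refl) (inj₂ (p , _)) (inj₁ q)       = inj₂ (p , q)
  Via-trans (x ∷ ws) (here refl) (inj₂ (p , _)) (inj₂ (_ , q)) = inj₂ (p , q)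
  Via-trans (x ∷ ws) (there w∈)  (inj₁ p)       (inj₁ q)       = inj₁ (Via-trans ws w∈ p q)
  Via-trans (x ∷ ws) (there w∈)  (inj₁ p)       (inj₂ (q , r)) = inj₂ (Via-trans ws w∈ p q , r)
  Via-trans (x ∷ ws) (there w∈)  (inj₂ (p , q)) (inj₁ r)       = inj₂ (p , Via-trans ws w∈ q r)
  Via-trans (x ∷ ws) (there w∈)  (inj₂ (p , _)) (inj₂ (_ , q)) = inj₂ (p , q)

  Star⇒Via : ∀ {u v} → Star R u v → Via (allFin n) u v
  Star⇒Via ε       = Via-base (allFin n) (inj₁ refl)
  Star⇒Via (r ◅ s) = Via-trans (allFin n) (∈-allFin _) (Via-base (allFin n) (inj₂ r)) (Star⇒Via s)

  star? : Rel.Decidable (Star R)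
  star? u v = map′ (Via⇒Star (allFin n)) Star⇒Via (via? (allFin n) u v)

least : {P : ℕ → Set} → (∀ d → Dec (P d)) → ∀ k → P k → ∃ (IsLeast P)
least P? zero    p = 0 , p , λ _ _ → z≤n
least {P} P? (suc k) p with P? 0
... | yes p₀ = 0 , p₀ , λ _ _ → z≤n
... | no ¬p₀ with least {P ∘ suc} (P? ∘ suc) k p
...   | d , pd , min = suc d , pd , λ where
          zero    p₀ → ⊥-elim (¬p₀ p₀)
          (suc j) pj → s≤s (min j pj)

module _ {n m : ℕ} (T : Tree n m) where
  open Tree T

  adjacent? : ∀ E → Rel.Decidable (Adjacent graph E)
  adjacent? E u v = any? λ e → (e ∈? E) ×-dec ≡-dec Bool._≟_ (set (edge e)) (⁅ u ⁆ ∪ ⁅ v ⁆)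

  isSubtree? : ∀ V E → Dec (IsSubtree T V E)
  isSubtree? V E =
    all? (λ e → (e ∈? E) →-dec (set (edge e) ⊆? V)) ×-dec
    all? (λ u → all? λ v → (u ∈? V) →-dec ((v ∈? V) →-dec star? (adjacent? E) u v))

  subtreeOfSize? : ∀ p d → Dec (SubtreeOfSize T p d)
  subtreeOfSize? p d = anySubset? λ V → anySubset? λ E →
    isSubtree? V E ×-dec ((p ⊆? V) ×-dec (∣ E ∣ ℕ.≟ d))

  -- Abstract so that the exhaustive search is never unfolded; the type
  -- determines the value.
  abstract
    steiner : ∀ p → ∃ (IsLeast (SubtreeOfSize T p))
    steiner p = least (subtreeOfSize? p) _ (⊤ , ⊤ , ((λ _ _ → ⊆⊤) , connected) , ⊆⊤ , refl)

  steinerDistance : Subset n → ℕ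
  steinerDistance p = proj₁ (steiner p)

  𝔇₂ : V₂ n → V₂ n → ℤ
  𝔇₂ p q = + steinerDistance (set p ∪ set q)

-- Coefficient lists, constant term first; trailing zeros are allowed.
Poly : Set
Poly = List ℤ

coeff : Poly → ℕ → ℤ
coeff []      _       = ℤ.0ℤ
coeff (a ∷ _) zero    = a
coeff (_ ∷ p) (suc k) = coeff p k

infixl 6 _+ₚ_
infixl 7 _*ₚ_
infix  8 -ₚ_

_+ₚ_ : Poly → Poly → Poly
[]      +ₚ q       = q
(a ∷ p) +ₚ []      = a ∷ p
(a ∷ p) +ₚ (b ∷ q) = (a ℤ.+ b) ∷ (p +ₚ q)

-ₚ_ : Poly → Poly
-ₚ_ = map (ℤ.-_)

_*ₚ_ : Poly → Poly → Poly
[]      *ₚ q = []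
(a ∷ p) *ₚ q = map (a ℤ.*_) q +ₚ (ℤ.0ℤ ∷ (p *ₚ q))

polyRawRing : RawRing 0ℓ 0ℓ
polyRawRing = record
  { Carrier = Poly
  ; _≈_     = λ p q → ∀ k → coeff p k ≡ coeff q k
  ; _+_     = _+ₚ_
  ; _*_     = _*ₚ_
  ; -_      = -ₚ_
  ; 0#      = []
  ; 1#      = ℤ.1ℤ ∷ []
  }

SquareMatrix : ∀ {a} → Set a → ℕ → Set a
SquareMatrix A k = Fin k → Fin k → A

-- Laplace expansion along the first row.
module _ {c ℓ} (R : RawRing c ℓ) where
  open RawRing R using (Carrier; _*_; -_; 1#; rawSemiring)
  open RawSemiringDefs rawSemiring using (sum; _^_)

  det : ∀ {k} → SquareMatrix Carrier k → Carrier
  det {zero}  M = 1#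
  det {suc k} M = sum λ j →
    ((- 1#) ^ toℕ j) * (M zero j * det (λ r s → M (suc r) (punchIn j s)))

-- det (x I − M)
charpoly : ∀ {k} → SquareMatrix ℤ k → Poly
charpoly M = det polyRawRing λ i j →
  (if does (i ≟ᶠ j) then X else []) +ₚ (-ₚ (M i j ∷ []))
  where
  X : Poly
  X = ℤ.0ℤ ∷ ℤ.1ℤ ∷ []

-- M [ B , B ], for B given as an enumeration of distinct indices.  The
-- order of the enumeration does not affect the characteristic polynomial.
principal : ∀ {A I : Set} {k} → (I → I → A) → (Fin k → I) → SquareMatrix A k
principal M B i j = M (B i) (B j)

-- ∣ a t ∣ = max { ∣ a k ∣ : 0 ≤ k ≤ N }
AttainsMaxAbs : (ℕ → ℤ) → ℕ → ℕ → Set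
AttainsMaxAbs a N t = t ≤ N × (∀ k → k ≤ N → ℤ.∣ a k ∣ ≤ ℤ.∣ a t ∣)

pattern v₀ = zero
pattern v₁ = suc zero
pattern v₂ = suc (suc zero)
pattern v₃ = suc (suc (suc zero))
pattern v₄ = suc (suc (suc (suc zero)))

-- S_{1,q} has n = 3 + q vertices; its edge eᵢ is the value at the index
-- whose toℕ is i − 1.
S-edge : ∀ q → Fin (2 + q) → V₂ (3 + q)
S-edge q zero          = pair v₀ v₁ λ ()
S-edge q (suc zero)    = pair v₁ v₂ λ ()
S-edge q (suc (suc i)) = pair v₂ (suc (suc (suc i))) λ ()

S-distinct : ∀ q {e f} → set (S-edge q e) ≡ set (S-edge q f) → e ≡ f
S-distinct q {zero}        {zero}        eq = refl
S-distinct q {suc zero}    {suc zero}    eq = refl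
S-distinct q {suc (suc i)} {suc (suc j)} eq with pair-injective v₂ (suc (suc (suc i))) v₂ (suc (suc (suc j))) (λ ()) eq
... | inj₁ (_ , refl) = refl
S-distinct q {zero}        {suc zero}    ()
S-distinct q {zero}        {suc (suc j)} ()
S-distinct q {suc zero}    {zero}        ()
S-distinct q {suc zero}    {suc (suc j)} ()
S-distinct q {suc (suc i)} {zero}        ()
S-distinct q {suc (suc i)} {suc zero}    ()

S-graph : ∀ q → Graph (3 + q) (2 + q)
S-graph q = record { edge = S-edge q ; distinct = S-distinct q }

module _ (q : ℕ) where

  Adj : Fin (3 + q) → Fin (3 + q) → Set
  Adj = Adjacent (S-graph q) ⊤

  Adj-sym : ∀ {u v} → Adj u v → Adj v u
  Adj-sym {u} {v} (e , e∈ , eq) = e , e∈ , trans eq (∪-comm ⁅ u ⁆ ⁅ v ⁆)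

  toCentre : ∀ u → Star Adj u v₂
  toCentre v₀                  = _◅_ {j = v₁} (v₀ , ∈⊤ , refl) ((v₁ , ∈⊤ , refl) ◅ ε)
  toCentre v₁                  = (v₁ , ∈⊤ , refl) ◅ ε
  toCentre v₂                  = ε
  toCentre (suc (suc (suc i))) = Adj-sym {v₂} {suc (suc (suc i))} (suc (suc i) , ∈⊤ , refl) ◅ ε

  S-connected : IsConnected (S-graph q) ⊤ ⊤
  S-connected u v _ _ = toCentre u ◅◅ reverse Adj-sym (toCentre v)

  leafNeighbour : Fin (3 + q) → Fin (3 + q)
  leafNeighbour zero    = v₁
  leafNeighbour (suc _) = v₂

  Inner : Fin (3 + q) → Set
  Inner u = u ≡ v₁ ⊎ u ≡ v₂

  inner-or-leaf : ∀ {u v} → Adj u v → Inner u ⊎ v ≡ leafNeighbour u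
  inner-or-leaf {u} {v} (zero , _ , eq) with pair-injective v₀ v₁ u v (λ ()) eq
  ... | inj₁ (refl , refl) = inj₂ refl
  ... | inj₂ (refl , refl) = inj₁ (inj₁ refl)
  inner-or-leaf {u} {v} (suc zero , _ , eq) with pair-injective v₁ v₂ u v (λ ()) eq
  ... | inj₁ (refl , refl) = inj₁ (inj₁ refl)
  ... | inj₂ (refl , refl) = inj₁ (inj₂ refl)
  inner-or-leaf {u} {v} (suc (suc i) , _ , eq) with pair-injective v₂ (suc (suc (suc i))) u v (λ ()) eq
  ... | inj₁ (refl , refl) = inj₁ (inj₂ refl)
  ... | inj₂ (refl , refl) = inj₂ refl

  two-neighbours : ∀ {u a b} → a ≢ b → Adj u a → Adj u b → Inner u
  two-neighbours a≢b ua ub with inner-or-leaf ua | inner-or-leaf ub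
  ... | inj₁ p  | _       = p
  ... | inj₂ _  | inj₁ p  = p
  ... | inj₂ ea | inj₂ eb = ⊥-elim (a≢b (trans ea (sym eb)))

  three-inner : ∀ {a b c} → a ≢ b → a ≢ c → b ≢ c → Inner a → Inner b → ¬ Inner c
  three-inner a≢b a≢c b≢c (inj₁ refl) (inj₁ refl) _           = a≢b refl
  three-inner a≢b a≢c b≢c (inj₁ refl) (inj₂ refl) (inj₁ refl) = a≢c refl
  three-inner a≢b a≢c b≢c (inj₁ refl) (inj₂ refl) (inj₂ refl) = b≢c refl
  three-inner a≢b a≢c b≢c (inj₂ refl) (inj₁ refl) (inj₁ refl) = b≢c refl
  three-inner a≢b a≢c b≢c (inj₂ refl) (inj₁ refl) (inj₂ refl) = a≢c refl
  three-inner a≢b a≢c b≢c (inj₂ refl) (inj₂ refl) _           = a≢b refl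

  S-acyclic : ¬ Cycle (S-graph q)
  S-acyclic C = three-inner (apart λ ()) (apart λ ()) (apart λ ())
    (two-neighbours (apart λ ()) (step zero) (Adj-sym close))
    (two-neighbours (apart λ ()) (Adj-sym (step zero)) (step (suc zero)))
    (two-neighbours (apart inject₁-fromℕ≢0) (Adj-sym (step (fromℕ (1 + k)))) close)
    where
    open Cycle C
    apart : ∀ {i j} → i ≢ j → vertex i ≢ vertex j
    apart i≢j eq = i≢j (injective eq)
    inject₁-fromℕ≢0 : inject₁ (fromℕ (1 + k)) ≢ zero
    inject₁-fromℕ≢0 ()

S₁ : ∀ q → Tree (3 + q) (2 + q)
S₁ q = record { graph = S-graph q ; connected = S-connected q ; acyclic = S-acyclic q }

B₁ : ∀ m → let q = 1 + m ; n = 3 + q in Fin (1 + n) → V₂ n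
B₁ m = pair v₀ v₂ (λ ()) Vector.∷ pair v₁ v₃ (λ ()) Vector.∷ S-edge (1 + m)

B₂ : ∀ m → let q = 2 + m ; n = 3 + q in Fin (1 + n) → V₂ n
B₂ m = pair v₀ v₂ (λ ()) Vector.∷ pair v₃ v₄ (λ ()) Vector.∷ S-edge (2 + m)

B₁-distinct : ∀ m {i j} → set (B₁ m i) ≡ set (B₁ m j) → i ≡ j
B₁-distinct m {v₀} {v₀} eq = refl
B₁-distinct m {v₁} {v₁} eq = refl
B₁-distinct m {suc (suc i)} {suc (suc j)} eq = cong (λ e → suc (suc e)) (S-distinct (1 + m) {i} {j} eq)
B₁-distinct m {v₀} {v₁} ()
B₁-distinct m {v₁} {v₀} ()
B₁-distinct m {v₀} {v₂} ()
B₁-distinct m {v₀} {v₃} ()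
B₁-distinct m {v₀} {suc (suc (suc (suc _)))} ()
B₁-distinct m {v₁} {v₂} ()
B₁-distinct m {v₁} {v₃} ()
B₁-distinct m {v₁} {suc (suc (suc (suc _)))} ()
B₁-distinct m {v₂} {v₀} ()
B₁-distinct m {v₃} {v₀} ()
B₁-distinct m {suc (suc (suc (suc _)))} {v₀} ()
B₁-distinct m {v₂} {v₁} ()
B₁-distinct m {v₃} {v₁} ()
B₁-distinct m {suc (suc (suc (suc _)))} {v₁} ()

B₂-distinct : ∀ m {i j} → set (B₂ m i) ≡ set (B₂ m j) → i ≡ j
B₂-distinct m {v₀} {v₀} eq = refl
B₂-distinct m {v₁} {v₁} eq = refl
B₂-distinct m {suc (suc i)} {suc (suc j)} eq = cong (λ e → suc (suc e)) (S-distinct (2 + m) {i} {j} eq)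
B₂-distinct m {v₀} {v₁} ()
B₂-distinct m {v₁} {v₀} ()
B₂-distinct m {v₀} {v₂} ()
B₂-distinct m {v₀} {v₃} ()
B₂-distinct m {v₀} {suc (suc (suc (suc _)))} ()
B₂-distinct m {v₁} {v₂} ()
B₂-distinct m {v₁} {v₃} ()
B₂-distinct m {v₁} {suc (suc (suc (suc _)))} ()
B₂-distinct m {v₂} {v₀} ()
B₂-distinct m {v₃} {v₀} ()
B₂-distinct m {suc (suc (suc (suc _)))} {v₀} ()
B₂-distinct m {v₂} {v₁} ()
B₂-distinct m {v₃} {v₁} ()
B₂-distinct m {suc (suc (suc (suc _)))} {v₁} ()

{-# OPTIONS --safe #-}
module Submission where

-- The minimal subtree of S_{1,q} containing a set p of at least two vertices
-- uses the leaf edges at the elements of p, and {v₁,v₂} exactly when p meets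
-- both sides of it; this gives every entry of the matrix.  All but the first
-- h = 5 (resp. 6) indices are leaf edges that look alike, and their columns
-- differ only by x + 1 on the diagonal.  Column operations then give
-- det Gₙ₊₁ = (x+1) det Gₙ + det Fₙ  and  det Fₙ₊₁ = (x+1) det Fₙ, so that the
-- characteristic polynomial is (x+1)^N (x⁶ − p₅x⁵ − … − p₀) with N = n − 5
-- and explicit positive pₖ linear in N, p₅ = 2N + 8.  Its t-th coefficient is
-- C(N,t−6) − Σ pₖ C(N,t−k), and comparing consecutive coefficients shows that
-- their absolute values increase strictly up to t = ⌊(N+1)/2⌋ and decrease
-- strictly from t = 5 + ⌊N/2⌋ on: the term C(N,t−6), of the opposite sign, is
-- absorbed by 2N C(N,t−5).  The case n = 4 is a direct computation.

open import Defs
open import Algebra.Bundles using (CommutativeRing)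
open import Algebra.Bundles.Raw using (RawRing)
open import Data.Bool.Base using (Bool; true; false; _∨_; _∧_; if_then_else_)
open import Data.Bool.Properties using (∨-assoc; ∨-identityʳ)
open import Data.Empty using (⊥-elim)
open import Data.Fin.Base using (Fin; zero; suc; fromℕ; inject₁; punchIn; toℕ; _↑ˡ_; _↑ʳ_)
open import Data.Fin.Properties using (any?; toℕ-inject₁; toℕ-fromℕ; fromℕ≢inject₁) renaming (_≟_ to _≟ᶠ_)
open import Data.Fin.Relation.Unary.Top using (view; ‵fromℕ; ‵inject₁)
open import Data.Nat.Base as ℕ using (ℕ; zero; suc; z≤n; s≤s)
import Data.Nat.Properties as ℕ
open import Function.Base using (_∘_)
open import Level using (0ℓ)
open import Relation.Binary.PropositionalEquality as ≡ using (_≡_; _≢_)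
open import Relation.Nullary.Decidable using (yes; no; does; dec-true; dec-false; True; toWitness; _×-dec_; ¬?)
open import Relation.Nullary.Negation using (contradiction)

-- Index arithmetic in `Fin`.

punchIn-inject₁ : ∀ {n} (i : Fin (suc n)) (j : Fin n) → punchIn (inject₁ i) (inject₁ j) ≡ inject₁ (punchIn i j)
punchIn-inject₁ zero    j       = ≡.refl
punchIn-inject₁ (suc i) zero    = ≡.refl
punchIn-inject₁ (suc i) (suc j) = ≡.cong suc (punchIn-inject₁ i j)

punchIn-inject₁-fromℕ : ∀ {n} (i : Fin (suc n)) → punchIn (inject₁ i) (fromℕ n) ≡ fromℕ (suc n)
punchIn-inject₁-fromℕ         zero    = ≡.refl
punchIn-inject₁-fromℕ {suc n} (suc i) = ≡.cong suc (punchIn-inject₁-fromℕ i)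

punchIn-fromℕ : ∀ {n} (j : Fin n) → punchIn (fromℕ n) j ≡ inject₁ j
punchIn-fromℕ zero    = ≡.refl
punchIn-fromℕ (suc j) = ≡.cong suc (punchIn-fromℕ j)

does-inject₁ : ∀ {n} (i j : Fin n) → does (inject₁ i ≟ᶠ inject₁ j) ≡ does (i ≟ᶠ j)
does-inject₁ zero    zero    = ≡.refl
does-inject₁ zero    (suc j) = ≡.refl
does-inject₁ (suc i) zero    = ≡.refl
does-inject₁ (suc i) (suc j) = does-inject₁ i j

-- Truncation at `h`: indices below `h` keep their identity, all later ones are merged into one
-- class. A matrix of any size is thus read off a template of size `suc h`.
clamp : ∀ h {n} → Fin n → Fin (suc h)
clamp zero    i       = zero
clamp (suc h) zero    = zero
clamp (suc h) (suc i) = suc (clamp h i)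

clamp-inject₁ : ∀ h {n} (i : Fin n) → clamp h (inject₁ i) ≡ clamp h i
clamp-inject₁ zero    i       = ≡.refl
clamp-inject₁ (suc h) zero    = ≡.refl
clamp-inject₁ (suc h) (suc i) = ≡.cong suc (clamp-inject₁ h i)

clamp-fromℕ : ∀ {h n} → h ℕ.≤ n → clamp h (fromℕ n) ≡ fromℕ h
clamp-fromℕ z≤n       = ≡.refl
clamp-fromℕ (s≤s h≤n) = ≡.cong suc (clamp-fromℕ h≤n)

-- Determinants over a commutative ring: the last column.

module Determinants {c ℓ} (R : CommutativeRing c ℓ) where
  open CommutativeRing R hiding (zero)
  open import Algebra.Properties.Ring ring using (-‿distribˡ-*; -0#≈0#; -‿involutive)
  open import Algebra.Properties.Semiring.Sum semiring using (sum; sum⁺-syntax; sum-cong-≋; sum-replicate-zero; sum-init-last; ∑-distrib-+; ∑-comm; *-distribˡ-sum)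
  open import Algebra.Properties.Semiring.Exp semiring using (_^_)
  open import Algebra.Properties.Semiring.Mult semiring using (_×_; ×-congʳ; ×-comm-*)
  open import Algebra.Solver.CommutativeMonoid *-commutativeMonoid as *-Solver using (_⊕_; _⊜_)
  open import Relation.Binary.Reasoning.Setoid setoid

  Mat : ℕ → Set c
  Mat = SquareMatrix Carrier

  ∣_∣ : ∀ {n} → Mat n → Carrier
  ∣ M ∣ = det rawRing M

  sgn : ℕ → Carrier
  sgn k = (- 1#) ^ k

  sgn-suc : ∀ k → sgn (suc k) ≈ - sgn k
  sgn-suc k = trans (sym (-‿distribˡ-* 1# (sgn k))) (-‿cong (*-identityˡ _))

  sgn-2+ : ∀ k → sgn (suc (suc k)) ≈ sgn k
  sgn-2+ k = trans (sgn-suc (suc k)) (trans (-‿cong (sgn-suc k)) (-‿involutive _))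

  sgn-double : ∀ k → sgn (k ℕ.+ k) ≈ 1#
  sgn-double zero    = refl
  sgn-double (suc k) = trans (reflexive (≡.cong (sgn ∘ suc) (ℕ.+-suc k k))) (trans (sgn-2+ (k ℕ.+ k)) (sgn-double k))

  ∑-cong : ∀ {n} (f g : Fin n → Carrier) → (∀ i → f i ≈ g i) → sum f ≈ sum g
  ∑-cong f g = sum-cong-≋ {_} {f} {g}

  sum-zero : ∀ {n} (t : Fin n → Carrier) → (∀ i → t i ≈ 0#) → sum t ≈ 0#
  sum-zero {n} t t≈0 = trans (∑-cong t (λ _ → 0#) t≈0) (sum-replicate-zero n)

  sum-single : ∀ {n} (t : Fin n → Carrier) i → (∀ j → j ≢ i → t j ≈ 0#) → sum t ≈ t i
  sum-single t zero    t≈0 = trans (+-congˡ (sum-zero (t ∘ suc) (λ j → t≈0 (suc j) (λ ())))) (+-identityʳ _)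
  sum-single t (suc i) t≈0 = trans (+-cong (t≈0 zero (λ ())) (sum-single (t ∘ suc) i (λ j j≢i → t≈0 (suc j) (λ { ≡.refl → j≢i ≡.refl })))) (+-identityˡ _)

  rowTerm : ∀ {n} → Mat (suc n) → Fin (suc n) → Carrier
  rowTerm M j = sgn (toℕ j) * (M zero j * ∣ (λ r s → M (suc r) (punchIn j s)) ∣)

  det-cong : ∀ {n} (M N : Mat n) → (∀ i j → M i j ≈ N i j) → ∣ M ∣ ≈ ∣ N ∣
  det-cong {zero}  M N M≈N = refl
  det-cong {suc n} M N M≈N = ∑-cong (rowTerm M) (rowTerm N) λ j →
    *-congˡ {sgn (toℕ j)} (*-cong (M≈N zero j) (det-cong _ _ (λ r s → M≈N (suc r) (punchIn j s))))

  initTerm : ∀ {n} → Mat (suc n) → Fin n → Carrier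
  initTerm M j = sgn (toℕ j) * (M zero (inject₁ j) * ∣ (λ r s → M (suc r) (punchIn (inject₁ j) s)) ∣)

  lastTerm : ∀ {n} → Mat (suc n) → Carrier
  lastTerm {n} M = sgn n * (M zero (fromℕ n) * ∣ (λ r s → M (suc r) (inject₁ s)) ∣)

  det-split : ∀ {n} (M : Mat (suc n)) → ∣ M ∣ ≈ sum (initTerm M) + lastTerm M
  det-split {n} M = trans (sum-init-last (rowTerm M)) (+-cong
    (∑-cong (rowTerm M ∘ inject₁) (initTerm M) λ j → *-congʳ (reflexive (≡.cong sgn (toℕ-inject₁ j))))
    (*-cong (reflexive (≡.cong sgn (toℕ-fromℕ n)))
      (*-congˡ (det-cong _ _ λ r s → reflexive (≡.cong (M (suc r)) (punchIn-fromℕ s))))))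

  columnTerm : ∀ {n} → Mat (suc n) → Fin (suc n) → Carrier
  columnTerm {n} M i = sgn (n ℕ.+ toℕ i) * (M i (fromℕ n) * ∣ (λ r s → M (punchIn i r) (inject₁ s)) ∣)

  -- Expand along the first row, then each minor that still has the last column along that column,
  -- by induction. Exchanging the two sums collects the first-row expansions of the new minors; the
  -- remaining corner term is the one for row zero.
  laplace-last : ∀ {n} (M : Mat (suc n)) → ∣ M ∣ ≈ sum (columnTerm M)
  laplace-last {zero}  M = refl
  laplace-last {suc n} M = begin
    ∣ M ∣
      ≈⟨ det-split M ⟩
    sum (initTerm M) + lastTerm M
      ≈⟨ +-congʳ (∑-cong (initTerm M) _ λ j → trans (*-congˡ (*-congˡ (laplace-last (λ r s → M (suc r) (punchIn (inject₁ j) s))))) (pull j)) ⟩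
    ∑[ j ≤ n ] ∑[ i ≤ n ] summand i j + lastTerm M
      ≈⟨ +-congʳ (∑-comm (λ j i → summand i j)) ⟩
    ∑[ i ≤ n ] ∑[ j ≤ n ] summand i j + lastTerm M
      ≈⟨ +-congʳ (∑-cong (λ i → ∑[ j ≤ n ] summand i j) (columnTerm M ∘ suc) push) ⟩
    sum (columnTerm M ∘ suc) + lastTerm M
      ≈⟨ +-comm _ _ ⟩
    lastTerm M + sum (columnTerm M ∘ suc)
      ≈⟨ +-congʳ (*-congʳ (reflexive (≡.cong sgn (≡.sym (ℕ.+-identityʳ (suc n)))))) ⟩
    columnTerm M zero + sum (columnTerm M ∘ suc) ∎
    where
    minor : Fin (suc n) → Fin (suc n) → Carrier
    minor i j = ∣ (λ r s → M (suc (punchIn i r)) (inject₁ (punchIn j s))) ∣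
    expanded : Fin (suc n) → Fin (suc n) → Carrier
    expanded i j = sgn (toℕ j) * (M zero (inject₁ j) * minor i j)
    summand : Fin (suc n) → Fin (suc n) → Carrier
    summand i j = sgn (n ℕ.+ toℕ i) * (M (suc i) (fromℕ (suc n)) * expanded i j)
    pull : ∀ j → sgn (toℕ j) * (M zero (inject₁ j) * sum (columnTerm (λ r s → M (suc r) (punchIn (inject₁ j) s)))) ≈ ∑[ i ≤ n ] summand i j
    pull j = trans (*-congˡ (*-distribˡ-sum (M zero (inject₁ j)) (columnTerm N))) (trans (*-distribˡ-sum (sgn (toℕ j)) (λ i → M zero (inject₁ j) * columnTerm N i))
      (∑-cong _ (λ i → summand i j) λ i →
        trans (*-congˡ (*-congˡ (*-congˡ (*-cong
          (reflexive (≡.cong (M (suc i)) (punchIn-inject₁-fromℕ j)))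
          (det-cong _ _ λ r s → reflexive (≡.cong (M (suc (punchIn i r))) (punchIn-inject₁ j s)))))))
        (*-Solver.solve 5 (λ a b c d e → a ⊕ (b ⊕ (c ⊕ (d ⊕ e))) ⊜ c ⊕ (d ⊕ (a ⊕ (b ⊕ e)))) refl
          (sgn (toℕ j)) (M zero (inject₁ j)) (sgn (n ℕ.+ toℕ i)) (M (suc i) (fromℕ (suc n))) (minor i j))))
      where
      N : Mat (suc n)
      N r s = M (suc r) (punchIn (inject₁ j) s)
    push : ∀ i → ∑[ j ≤ n ] summand i j ≈ columnTerm M (suc i)
    push i = sym (trans
      (*-cong (trans (reflexive (≡.cong (sgn ∘ suc) (ℕ.+-suc n (toℕ i)))) (sgn-2+ (n ℕ.+ toℕ i))) (*-distribˡ-sum (M (suc i) (fromℕ (suc n))) (expanded i)))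
      (*-distribˡ-sum (sgn (n ℕ.+ toℕ i)) (λ j → M (suc i) (fromℕ (suc n)) * expanded i j)))

  det-last-+ : ∀ {n} (A B C : Mat (suc n)) →
    (∀ i j → A i (inject₁ j) ≈ B i (inject₁ j)) →
    (∀ i j → A i (inject₁ j) ≈ C i (inject₁ j)) →
    (∀ i → A i (fromℕ n) ≈ B i (fromℕ n) + C i (fromℕ n)) →
    ∣ A ∣ ≈ ∣ B ∣ + ∣ C ∣
  det-last-+ {n} A B C A≈B A≈C A≈B+C = begin
    ∣ A ∣
      ≈⟨ laplace-last A ⟩
    sum (columnTerm A)
      ≈⟨ ∑-cong (columnTerm A) (λ i → columnTerm B i + columnTerm C i) (λ i → trans (*-congˡ (trans (*-congʳ (A≈B+C i)) (trans (distribʳ _ _ _)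
           (+-cong (*-congˡ (det-cong _ _ λ r s → A≈B (punchIn i r) s)) (*-congˡ (det-cong _ _ λ r s → A≈C (punchIn i r) s))))))
           (distribˡ _ _ _)) ⟩
    ∑[ i ≤ n ] (columnTerm B i + columnTerm C i)
      ≈⟨ ∑-distrib-+ (columnTerm B) (columnTerm C) ⟩
    sum (columnTerm B) + sum (columnTerm C)
      ≈⟨ +-cong (laplace-last B) (laplace-last C) ⟨
    ∣ B ∣ + ∣ C ∣ ∎

  det-last-single : ∀ {n} (M : Mat (suc n)) i → (∀ r → r ≢ i → M r (fromℕ n) ≈ 0#) → ∣ M ∣ ≈ columnTerm M i
  det-last-single {n} M i M≈0 = trans (laplace-last M) (sum-single (columnTerm M) i λ r r≢i →
    trans (*-congˡ {sgn (n ℕ.+ toℕ r)} (trans (*-congʳ {∣ (λ r′ s → M (punchIn r r′) (inject₁ s)) ∣} (M≈0 r r≢i)) (zeroˡ _))) (zeroʳ _))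

  -- In the first-row expansion, the two terms at the equal columns have the same minor and opposite
  -- signs. All other minors still contain both columns and vanish by induction.
  det-last-repeat : ∀ {n} (M : Mat (suc (suc n))) →
    (∀ i → M i (fromℕ (suc n)) ≈ M i (inject₁ (fromℕ n))) → ∣ M ∣ ≈ 0#
  det-last-repeat {n} M rep = begin
    ∣ M ∣
      ≈⟨ det-split M ⟩
    sum (initTerm M) + lastTerm M
      ≈⟨ +-congʳ (sum-init-last (initTerm M)) ⟩
    (sum (initTerm M ∘ inject₁) + initTerm M (fromℕ n)) + lastTerm M
      ≈⟨ +-cong (+-cong (sum-zero (initTerm M ∘ inject₁) (front n M rep)) (*-congʳ (reflexive (≡.cong sgn (toℕ-fromℕ n)))))
           (trans (*-cong (sgn-suc n) (*-cong (rep zero) (det-cong _ _ λ r s → sym (columns r s)))) (sym (-‿distribˡ-* _ _))) ⟩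
    (0# + X) + - X
      ≈⟨ +-congʳ (+-identityˡ X) ⟩
    X + - X
      ≈⟨ -‿inverseʳ X ⟩
    0# ∎
    where
    X : Carrier
    X = sgn n * (M zero (inject₁ (fromℕ n)) * ∣ (λ r s → M (suc r) (punchIn (inject₁ (fromℕ n)) s)) ∣)
    columns : ∀ r s → M (suc r) (punchIn (inject₁ (fromℕ n)) s) ≈ M (suc r) (inject₁ s)
    columns r s with view s
    ... | ‵fromℕ      = trans (reflexive (≡.cong (M (suc r)) (punchIn-inject₁-fromℕ (fromℕ n)))) (rep (suc r))
    ... | ‵inject₁ s′ = reflexive (≡.cong (M (suc r)) (≡.trans (punchIn-inject₁ (fromℕ n) s′) (≡.cong inject₁ (punchIn-fromℕ s′))))
    -- The size is an explicit argument: `j : Fin n` forces it to be a successor, so the minor again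
    -- has two columns to compare.
    front : ∀ n (M : Mat (suc (suc n))) → (∀ i → M i (fromℕ (suc n)) ≈ M i (inject₁ (fromℕ n))) →
      ∀ (j : Fin n) → initTerm M (inject₁ j) ≈ 0#
    front (suc n) M rep j = trans (*-congˡ (trans (*-congˡ (det-last-repeat (λ r s → M (suc r) (punchIn (inject₁ (inject₁ j)) s)) λ i →
      trans (reflexive (≡.cong (M (suc i)) (punchIn-inject₁-fromℕ (inject₁ j))))
      (trans (rep (suc i))
      (reflexive (≡.cong (M (suc i)) (≡.sym (≡.trans (punchIn-inject₁ (inject₁ j) (fromℕ n)) (≡.cong inject₁ (punchIn-inject₁-fromℕ j)))))))))
      (zeroʳ _))) (zeroʳ _)

  withLast : ∀ {n} → Mat (suc n) → (Fin (suc n) → Carrier) → Mat (suc n)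
  withLast {n} M v i j = if does (j ≟ᶠ fromℕ n) then v i else M i j

  withLast-inject₁ : ∀ {n} (M : Mat (suc n)) v i j → withLast M v i (inject₁ j) ≡ M i (inject₁ j)
  withLast-inject₁ {n} M v i j rewrite dec-false (inject₁ j ≟ᶠ fromℕ n) (fromℕ≢inject₁ ∘ ≡.sym) = ≡.refl

  withLast-fromℕ : ∀ {n} (M : Mat (suc n)) v i → withLast M v i (fromℕ n) ≡ v i
  withLast-fromℕ {n} M v i rewrite dec-true (fromℕ n ≟ᶠ fromℕ n) ≡.refl = ≡.refl

  -- Determinants of matrices with many similar columns.

  module Clamped (h : ℕ) (T : Mat (suc h)) (d : Fin (suc h) → Carrier) where

    y : Carrier
    y = d (fromℕ h)

    -- Distinct indices from `h` on have equal clamps, so `T` gives only the value off the diagonal;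
    -- the correction `d` is added where the indices themselves agree. This is the matrix G of the
    -- recursion.
    clamped : ∀ n → Mat n
    clamped n i j = T (clamp h i) (clamp h j) + (if does (i ≟ᶠ j) then d (clamp h j) else 0#)

    -- The matrix F of the recursion: the last column has lost its diagonal correction.
    bordered : ∀ n → Mat (suc n)
    bordered n = withLast (clamped (suc n)) (λ i → T (clamp h i) (fromℕ h))

    clamped-inject₁ : ∀ {n} (i j : Fin n) → clamped (suc n) (inject₁ i) (inject₁ j) ≡ clamped n i j
    clamped-inject₁ i j rewrite clamp-inject₁ h i | clamp-inject₁ h j | does-inject₁ i j = ≡.refl

    clamped-off : ∀ {n} {i j : Fin n} → i ≢ j → clamped n i j ≈ T (clamp h i) (clamp h j)
    clamped-off {_} {i} {j} i≢j rewrite dec-false (i ≟ᶠ j) i≢j = +-identityʳ _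

    column : ∀ {n} (j : Fin n) → clamp h j ≡ fromℕ h → ∀ i →
      clamped n i j ≈ (if does (i ≟ᶠ j) then y else 0#) + T (clamp h i) (fromℕ h)
    column j eq i rewrite eq = +-comm _ _

    spike : ∀ {n} → Fin n → Fin n → Carrier
    spike j i = if does (i ≟ᶠ j) then y else 0#

    spike-on : ∀ {n} (j : Fin n) → spike j j ≡ y
    spike-on j rewrite dec-true (j ≟ᶠ j) ≡.refl = ≡.refl

    spike-off : ∀ {n} {j : Fin n} i → i ≢ j → spike j i ≡ 0#
    spike-off {_} {j} i i≢j rewrite dec-false (i ≟ᶠ j) i≢j = ≡.refl

    -- Since `h ≤ n`, the last column is the template column plus a single `y` in the corner, and
    -- the determinant is additive in it. The corner has sign (-1)^(2n).
    det-clamped-suc : ∀ {n} → h ℕ.≤ n → ∣ clamped (suc n) ∣ ≈ y * ∣ clamped n ∣ + ∣ bordered n ∣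
    det-clamped-suc {n} h≤n = begin
      ∣ M ∣
        ≈⟨ det-last-+ M S (bordered n)
             (λ i j → reflexive (≡.sym (withLast-inject₁ M v i j)))
             (λ i j → reflexive (≡.sym (withLast-inject₁ M u i j)))
             (λ i → trans (column (fromℕ n) (clamp-fromℕ h≤n) i) (reflexive (≡.sym (≡.cong₂ _+_ (withLast-fromℕ M v i) (withLast-fromℕ M u i))))) ⟩
      ∣ S ∣ + ∣ bordered n ∣
        ≈⟨ +-congʳ (det-last-single S (fromℕ n) λ r r≢ → reflexive (≡.trans (withLast-fromℕ M v r) (spike-off r r≢))) ⟩
      columnTerm S (fromℕ n) + ∣ bordered n ∣
        ≈⟨ +-congʳ (*-cong
             (trans (reflexive (≡.cong (λ k → sgn (n ℕ.+ k)) (toℕ-fromℕ n))) (sgn-double n))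
             (*-cong (reflexive (≡.trans (withLast-fromℕ M v (fromℕ n)) (spike-on (fromℕ n))))
               (det-cong _ _ λ r s → reflexive (≡.trans (withLast-inject₁ M v (punchIn (fromℕ n) r) s)
                 (≡.trans (≡.cong (λ i → M i (inject₁ s)) (punchIn-fromℕ r)) (clamped-inject₁ r s)))))) ⟩
      1# * (y * ∣ clamped n ∣) + ∣ bordered n ∣
        ≈⟨ +-congʳ (*-identityˡ _) ⟩
      y * ∣ clamped n ∣ + ∣ bordered n ∣ ∎
      where
      M S : Mat (suc n)
      M = clamped (suc n)
      u v : Fin (suc n) → Carrier
      u i = T (clamp h i) (fromℕ h)
      v = spike (fromℕ n)
      S = withLast M v

    -- Subtracting the last but one column from the last leaves a single entry, − y, in the last column.
    det-bordered-suc : ∀ {n} → h ℕ.≤ n → ∣ bordered (suc n) ∣ ≈ y * ∣ bordered n ∣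
    det-bordered-suc {n} h≤n = begin
      ∣ bordered (suc n) ∣
        ≈⟨ det-last-+ (bordered (suc n)) S D
             (λ i j → reflexive (≡.trans (withLast-inject₁ M u i j) (≡.sym (withLast-inject₁ M v i j))))
             (λ i j → reflexive (≡.trans (withLast-inject₁ M u i j) (≡.sym (withLast-inject₁ M w i j))))
             (λ i → trans (reflexive (withLast-fromℕ M u i)) (trans (difference i)
               (reflexive (≡.sym (≡.cong₂ _+_ (withLast-fromℕ M v i) (withLast-fromℕ M w i)))))) ⟩
      ∣ S ∣ + ∣ D ∣
        ≈⟨ +-cong (det-last-single S p λ r r≢ → trans (reflexive (≡.trans (withLast-fromℕ M v r) (≡.cong -_ (spike-off r r≢)))) -0#≈0#)
                  (det-last-repeat D λ i → reflexive (≡.trans (withLast-fromℕ M w i) (≡.sym (withLast-inject₁ M w i (fromℕ n))))) ⟩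
      columnTerm S p + 0#
        ≈⟨ +-identityʳ _ ⟩
      columnTerm S p
        -- The entry - y stands one row above the corner, so its sign is (-1)^(2n+1) and the two
        -- minus signs cancel.
        ≈⟨ *-cong
             (trans (reflexive (≡.cong (λ k → sgn (suc n ℕ.+ k)) (≡.trans (toℕ-inject₁ (fromℕ n)) (toℕ-fromℕ n)))) (trans (sgn-suc (n ℕ.+ n)) (-‿cong (sgn-double n))))
             (*-cong (reflexive (≡.trans (withLast-fromℕ M v p) (≡.cong -_ (spike-on p))))
               (det-cong _ _ λ r s → trans (reflexive (withLast-inject₁ M v (punchIn p r) s)) (minor r s))) ⟩
      - 1# * (- y * ∣ bordered n ∣)
        ≈⟨ trans (sym (-‿distribˡ-* _ _)) (trans (-‿cong (trans (*-identityˡ _) (sym (-‿distribˡ-* _ _)))) (-‿involutive _)) ⟩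
      y * ∣ bordered n ∣ ∎
      where
      M S D : Mat (suc (suc n))
      p : Fin (suc (suc n))
      p = inject₁ (fromℕ n)
      M = clamped (suc (suc n))
      u v w : Fin (suc (suc n)) → Carrier
      u i = T (clamp h i) (fromℕ h)
      v i = - spike p i
      w i = M i p
      u′ : Fin (suc n) → Carrier
      u′ i = T (clamp h i) (fromℕ h)
      S = withLast M v
      D = withLast M w
      difference : ∀ i → T (clamp h i) (fromℕ h) ≈ - spike p i + M i p
      difference i = sym (trans (+-congˡ (column p (≡.trans (clamp-inject₁ h (fromℕ n)) (clamp-fromℕ h≤n)) i))
        (trans (sym (+-assoc _ _ _)) (trans (+-congʳ (-‿inverseˡ _)) (+-identityˡ _))))
      -- With row `p` gone, column `p` has no diagonal entry left and serves as the border. The last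
      -- row takes the place of row `p`: the two agree off the diagonal because their indices have
      -- the same clamp.
      minor : ∀ r s → M (punchIn p r) (inject₁ s) ≈ bordered n r s
      minor r s with view r | view s
      ... | ‵inject₁ r′ | ‵inject₁ s′ = reflexive (≡.trans
        (≡.cong (λ i → M i (inject₁ (inject₁ s′))) (≡.trans (punchIn-inject₁ (fromℕ n) r′) (≡.cong inject₁ (punchIn-fromℕ r′))))
        (≡.trans (clamped-inject₁ (inject₁ r′) (inject₁ s′)) (≡.sym (withLast-inject₁ (clamped (suc n)) u′ (inject₁ r′) s′))))
      ... | ‵inject₁ r′ | ‵fromℕ      = trans (reflexive (≡.trans
        (≡.cong (λ i → M i p) (≡.trans (punchIn-inject₁ (fromℕ n) r′) (≡.cong inject₁ (punchIn-fromℕ r′))))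
        (clamped-inject₁ (inject₁ r′) (fromℕ n))))
        (trans (clamped-off (fromℕ≢inject₁ ∘ ≡.sym)) (reflexive (≡.trans (≡.cong (T (clamp h (inject₁ r′))) (clamp-fromℕ h≤n))
          (≡.sym (withLast-fromℕ (clamped (suc n)) u′ (inject₁ r′))))))
      ... | ‵fromℕ      | ‵inject₁ s′ = trans (reflexive (≡.cong (λ i → M i (inject₁ (inject₁ s′))) (punchIn-inject₁-fromℕ (fromℕ n))))
        (trans (clamped-off fromℕ≢inject₁)
        (trans (reflexive (≡.cong₂ T (≡.trans (clamp-fromℕ (ℕ.m≤n⇒m≤1+n h≤n)) (≡.sym (clamp-fromℕ h≤n))) (clamp-inject₁ h (inject₁ s′))))
        (trans (sym (clamped-off fromℕ≢inject₁)) (reflexive (≡.sym (withLast-inject₁ (clamped (suc n)) u′ (fromℕ n) s′))))))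
      ... | ‵fromℕ      | ‵fromℕ      = trans (reflexive (≡.cong (λ i → M i p) (punchIn-inject₁-fromℕ (fromℕ n))))
        (trans (clamped-off fromℕ≢inject₁)
        (reflexive (≡.trans (≡.cong₂ T (≡.trans (clamp-fromℕ (ℕ.m≤n⇒m≤1+n h≤n)) (≡.sym (clamp-fromℕ h≤n))) (≡.trans (clamp-inject₁ h (fromℕ n)) (clamp-fromℕ h≤n)))
          (≡.sym (withLast-fromℕ (clamped (suc n)) u′ (fromℕ n))))))

    det-bordered : ∀ k → ∣ bordered (k ℕ.+ h) ∣ ≈ ∣ bordered h ∣ * y ^ k
    det-bordered zero    = sym (*-identityʳ _)
    det-bordered (suc k) = trans (det-bordered-suc (ℕ.m≤n+m h k)) (trans (*-congˡ (det-bordered k))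
      (*-Solver.solve 3 (λ a b c → a ⊕ (b ⊕ c) ⊜ b ⊕ (a ⊕ c)) refl _ _ _))

    -- Each step multiplies by `y` and adds another copy of the bordered determinant times a power
    -- of `y`; one power of `y` fewer than the growth in size comes out.
    det-clamped : ∀ k → ∣ clamped (suc k ℕ.+ h) ∣ ≈ (y * ∣ clamped h ∣ + suc k × ∣ bordered h ∣) * y ^ k
    det-clamped zero    = trans (det-clamped-suc ℕ.≤-refl) (trans (+-congˡ (sym (+-identityʳ _))) (sym (*-identityʳ _)))
    det-clamped (suc k) = begin
      ∣ clamped (suc (suc k) ℕ.+ h) ∣
        ≈⟨ det-clamped-suc (ℕ.m≤n⇒m≤1+n (ℕ.m≤n+m h k)) ⟩
      y * ∣ clamped (suc k ℕ.+ h) ∣ + ∣ bordered (suc k ℕ.+ h) ∣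
        ≈⟨ +-cong (*-congˡ (det-clamped k)) (det-bordered (suc k)) ⟩
      y * ((P + Q) * y ^ k) + F * y ^ suc k
        ≈⟨ +-congʳ (*-Solver.solve 3 (λ a b c → a ⊕ (b ⊕ c) ⊜ b ⊕ (a ⊕ c)) refl _ _ _) ⟩
      (P + Q) * y ^ suc k + F * y ^ suc k
        ≈⟨ distribʳ _ _ _ ⟨
      ((P + Q) + F) * y ^ suc k
        ≈⟨ *-congʳ (trans (+-assoc _ _ _) (+-congˡ (+-comm _ _))) ⟩
      (P + (F + Q)) * y ^ suc k ∎
      where
      F = ∣ bordered h ∣
      P = y * ∣ clamped h ∣
      Q = suc k × F

    -- If `y` divides the bordered determinant, the full power comes out and the formula already
    -- holds at `k = 0`.
    det-clamped-factor : ∀ {f} → ∣ bordered h ∣ ≈ y * f → ∀ k → ∣ clamped (k ℕ.+ h) ∣ ≈ (∣ clamped h ∣ + k × f) * y ^ k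
    det-clamped-factor     F≈yf zero    = sym (trans (*-identityʳ _) (+-identityʳ _))
    det-clamped-factor {f} F≈yf (suc k) = begin
      ∣ clamped (suc k ℕ.+ h) ∣
        ≈⟨ det-clamped k ⟩
      (y * ∣ clamped h ∣ + suc k × ∣ bordered h ∣) * y ^ k
        ≈⟨ *-congʳ (+-congˡ (trans (×-congʳ (suc k) F≈yf) (sym (×-comm-* (suc k) y f)))) ⟩
      (y * ∣ clamped h ∣ + y * (suc k × f)) * y ^ k
        ≈⟨ *-congʳ (distribˡ _ _ _) ⟨
      (y * (∣ clamped h ∣ + suc k × f)) * y ^ k
        ≈⟨ *-Solver.solve 3 (λ a b c → (a ⊕ b) ⊕ c ⊜ b ⊕ (a ⊕ c)) refl _ _ _ ⟩
      (∣ clamped h ∣ + suc k × f) * y ^ suc k ∎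

-- Binomial coefficients

open import Data.Product.Base using (∃; _×_; _,_; proj₂)
open import Data.Sum.Base using (_⊎_; inj₁; inj₂)
open import Data.Integer.Base as ℤ using (ℤ; 0ℤ; 1ℤ; _⊖_)
import Data.Integer.Properties as ℤ
open import Data.Nat.Base using (_+_; _*_; _∸_; _≤_; _<_; NonZero; ⌊_/2⌋; ⌈_/2⌉; >-nonZero)
open import Data.Nat.Combinatorics using (_C_; nCk+nC[k+1]≡[n+1]C[k+1]; nC1≡n; nCn≡1; k>n⇒nCk≡0)
open import Data.Nat.Properties
open import Data.Nat.Tactic.RingSolver using (solve-∀)
open import Relation.Binary.PropositionalEquality using (refl; sym; trans; cong; cong₂; subst; subst₂)

-- The absorption identity free of subtraction, so that Pascal's rule proves it by induction. All
-- comparisons below rest on the ratio (n - k)/(k + 1) that it yields.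
C-absorb-+ : ∀ n k → suc k * (n C suc k) + k * (n C k) ≡ n * (n C k)
C-absorb-+ zero    zero    = refl
C-absorb-+ zero    (suc k) = cong₂ _+_ (*-zeroʳ k) (*-zeroʳ k)
C-absorb-+ (suc n) zero    = trans (+-identityʳ _) (trans (+-identityʳ _) (trans (nC1≡n (suc n)) (sym (*-identityʳ (suc n)))))
C-absorb-+ (suc n) (suc k)
  rewrite sym (nCk+nC[k+1]≡[n+1]C[k+1] n k) | sym (nCk+nC[k+1]≡[n+1]C[k+1] n (suc k)) =
  trans (regroup k (n C k) (n C suc k) (n C suc (suc k)))
  (trans (cong₂ (λ u w → (u + w) + (n C k + n C suc k)) (C-absorb-+ n (suc k)) (C-absorb-+ n k))
  (collect n (n C k) (n C suc k)))
  where
  regroup : ∀ k a b d → suc (suc k) * (b + d) + suc k * (a + b) ≡ ((suc (suc k) * d + suc k * b) + (suc k * b + k * a)) + (a + b)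
  regroup = solve-∀
  collect : ∀ n a b → (n * b + n * a) + (a + b) ≡ suc n * (a + b)
  collect = solve-∀

C-absorb : ∀ n k → suc k * (n C suc k) ≡ (n ∸ k) * (n C k)
C-absorb n k = trans (sym (m+n∸n≡m _ (k * (n C k))))
  (trans (cong (_∸ k * (n C k)) (C-absorb-+ n k)) (sym (*-distribʳ-∸ (n C k) n k)))

C-pos : ∀ {n k} → k ≤ n → 0 < n C k
C-pos {n}     z≤n       = s≤s z≤n
C-pos {suc n} {suc k} (s≤s k≤n) = subst (0 <_) (nCk+nC[k+1]≡[n+1]C[k+1] n k) (<-≤-trans (C-pos k≤n) (m≤m+n _ _))

C-increasing : ∀ {n k} → k + suc k ≤ n → n C k ≤ n C suc k
C-increasing {n} {k} le = *-cancelˡ-≤ (suc k) (subst (suc k * (n C k) ≤_) (sym (C-absorb n k))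
  (*-monoˡ-≤ (n C k) (m+n≤o⇒n≤o∸m k le)))
  where
  m+n≤o⇒n≤o∸m : ∀ m {n o} → m + n ≤ o → n ≤ o ∸ m
  m+n≤o⇒n≤o∸m m {n} le = subst (_≤ _) (m+n∸m≡n m n) (∸-monoˡ-≤ m le)

C-increasing-< : ∀ {n k} → k + suc k < n → n C k < n C suc k
C-increasing-< {n} {k} lt = *-cancelˡ-< (suc k) _ _ (subst (suc k * (n C k) <_) (sym (C-absorb n k))
  (*-monoˡ-< (n C k) ⦃ >-nonZero (C-pos (≤-trans (m≤m+n k (suc k)) (<⇒≤ lt))) ⦄
    (subst (_≤ n ∸ k) (m+n∸m≡n k (suc (suc k))) (∸-monoˡ-≤ k (subst (_≤ n) (sym (+-suc k (suc k))) lt)))))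

C-decreasing : ∀ {n k} → n ≤ k + suc k → n C suc k ≤ n C k
C-decreasing {n} {k} le = *-cancelˡ-≤ (suc k) (subst (_≤ suc k * (n C k)) (sym (C-absorb n k))
  (*-monoˡ-≤ (n C k) (m≤n+o⇒m∸n≤o n k le)))

C-decreasing-< : ∀ {n k} → n < k + suc k → k ≤ n → n C suc k < n C k
C-decreasing-< {n} {k} lt k≤n = *-cancelˡ-< (suc k) _ _ (subst (_< suc k * (n C k)) (sym (C-absorb n k))
  (*-monoˡ-< (n C k) ⦃ >-nonZero (C-pos k≤n) ⦄ (s≤s (m≤n+o⇒m∸n≤o n k (≤-pred (subst (n <_) (+-suc k k) lt))))))

-- A quantitative increase: below the middle the ratio is at least (k+2)/(k+1), so 2n times the
-- increment is at least (2n/(k+1)) C(n,k), hence at least C(n,k).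
C-growth : ∀ {n k} → k + suc (suc k) ≤ n → n C k + 2 * n * (n C k) ≤ 2 * n * (n C suc k)
C-growth {n} {k} le = *-cancelˡ-≤ (suc k) (begin
  suc k * (X + 2 * n * X)            ≡⟨ expand (suc k) n X ⟩
  suc k * X + 2 * n * (suc k) * X    ≤⟨ +-monoˡ-≤ _ (*-monoˡ-≤ X (≤-trans sk≤n (m≤n*m n 2))) ⟩
  2 * n * X + 2 * n * (suc k) * X    ≡⟨ combine k n X ⟩
  2 * n * (suc (suc k) * X)          ≤⟨ *-monoʳ-≤ (2 * n) (*-monoˡ-≤ X (subst (_≤ n ∸ k) (m+n∸m≡n k (suc (suc k))) (∸-monoˡ-≤ k le))) ⟩
  2 * n * ((n ∸ k) * X)              ≡⟨ cong (2 * n *_) (sym (C-absorb n k)) ⟩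
  2 * n * (suc k * Y)                ≡⟨ swap (2 * n) (suc k) Y ⟩
  suc k * (2 * n * Y)                ∎)
  where
  open ≤-Reasoning
  X Y : ℕ
  X = n C k
  Y = n C suc k
  sk≤n : suc k ≤ n
  sk≤n = ≤-trans (n≤1+n (suc k)) (≤-trans (m≤n+m (suc (suc k)) k) le)
  expand : ∀ a n x → a * (x + 2 * n * x) ≡ a * x + 2 * n * a * x
  expand = solve-∀
  combine : ∀ k n x → 2 * n * x + 2 * n * (suc k) * x ≡ 2 * n * (suc (suc k) * x)
  combine = solve-∀
  swap : ∀ a b y → a * (b * y) ≡ b * (a * y)
  swap = solve-∀

-- Past the middle, 2n times the drop from C(n,r+1) to C(n,r+2) covers the possible excess of C(n,r)
-- over C(n,r+1). Multiplying by `g * suc v` turns all three binomials into multiples of the middle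
-- one.
C-three-term : ∀ {n r} → suc r ≤ n → n ≤ suc r + suc (suc r) →
  n C r + 2 * n * (n C suc (suc r)) ≤ n C suc r + 2 * n * (n C suc r)
C-three-term {n} {r} sr≤n n≤ = *-cancelˡ-≤ (g * suc v) ⦃ m*n≢0 g (suc v) ⦄ (begin
  g * suc v * (Z + 2 * n * Y)                          ≡⟨ expand g v n Y Z ⟩
  g * (suc v * Z) + 2 * n * suc v * (g * Y)            ≡⟨ cong₂ (λ a b → g * a + 2 * n * suc v * b) (sym absorbX) absorbY ⟩
  g * (suc r * X) + 2 * n * suc v * (v * X)            ≡⟨ collect g (suc r) v n X ⟩
  (g * suc r + 2 * n * suc v * v) * X                  ≤⟨ *-monoˡ-≤ X (+-monoˡ-≤ _ key) ⟩
  (g * suc v + 2 * n * suc v * e + 2 * n * suc v * v) * X ≡⟨ regroup g v e n X ⟩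
  (g * suc v + 2 * n * suc v * (v + e)) * X            ≡⟨ cong (λ k → (g * suc v + 2 * n * suc v * k) * X) v+e≡g ⟩
  (g * suc v + 2 * n * suc v * g) * X                  ≡⟨ factor g v n X ⟩
  g * suc v * (X + 2 * n * X)                          ∎)
  where
  open ≤-Reasoning
  X Y Z g v e : ℕ
  X = n C suc r
  Y = n C suc (suc r)
  Z = n C r
  g = suc (suc r)
  v = n ∸ suc r
  e = g ∸ v
  v+e≡g : v + e ≡ g
  v+e≡g = m+[n∸m]≡n (m≤n+o⇒m∸n≤o n (suc r) n≤)
  absorbY : g * Y ≡ v * X
  absorbY = C-absorb n (suc r)
  absorbX : suc r * X ≡ suc v * Z
  absorbX = trans (C-absorb n r) (cong (_* Z) (+-∸-assoc 1 sr≤n))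
  -- If `e` is zero, then `v` equals r + 2 and the first summand suffices. Otherwise the second
  -- does, by r + 1 ≤ 2n and v + e ≤ (v + 1)e.
  key : g * suc r ≤ g * suc v + 2 * n * suc v * e
  key with e in eq
  ... | zero   = ≤-trans (*-monoʳ-≤ g (≤-trans (n≤1+n (suc r)) (≤-trans (≤-reflexive (trans (sym v+e≡g) (trans (cong (v +_) eq) (+-identityʳ v)))) (n≤1+n v)))) (m≤m+n _ _)
  ... | suc e′ = ≤-trans (begin
      g * suc r                 ≡⟨ *-comm g (suc r) ⟩
      suc r * g                 ≡⟨ cong (suc r *_) (trans (sym v+e≡g) (cong (v +_) eq)) ⟩
      suc r * (v + suc e′)      ≤⟨ *-mono-≤ (≤-trans sr≤n (m≤n*m n 2)) (≤-trans (m≤m+n (v + suc e′) (v * e′)) (≤-reflexive (product v e′))) ⟩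
      2 * n * (suc v * suc e′)  ≡⟨ sym (*-assoc (2 * n) (suc v) (suc e′)) ⟩
      2 * n * suc v * suc e′    ∎) (m≤n+m _ _)
    where
    product : ∀ v e → v + suc e + v * e ≡ suc v * suc e
    product = solve-∀
  expand : ∀ g v n y z → g * suc v * (z + 2 * n * y) ≡ g * (suc v * z) + 2 * n * suc v * (g * y)
  expand = solve-∀
  collect : ∀ g r v n x → g * (r * x) + 2 * n * suc v * (v * x) ≡ (g * r + 2 * n * suc v * v) * x
  collect = solve-∀
  regroup : ∀ g v e n x → (g * suc v + 2 * n * suc v * e + 2 * n * suc v * v) * x ≡ (g * suc v + 2 * n * suc v * (v + e)) * x
  regroup = solve-∀
  factor : ∀ g v n x → (g * suc v + 2 * n * suc v * g) * x ≡ g * suc v * (x + 2 * n * x)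
  factor = solve-∀

-- In the absorption identity the factor n - r is at least 1, and r + 1 is at most 2n.
C-pred≤ : ∀ {n r} → suc r ≤ n → n C r ≤ 2 * n * (n C suc r)
C-pred≤ {n} {r} sr≤n = begin
  n C r                  ≤⟨ m≤n*m (n C r) (n ∸ r) ⦃ >-nonZero (m<n⇒0<n∸m sr≤n) ⦄ ⟩
  (n ∸ r) * (n C r)      ≡⟨ sym (C-absorb n r) ⟩
  suc r * (n C suc r)    ≤⟨ *-monoˡ-≤ (n C suc r) (≤-trans sr≤n (m≤n*m n 2)) ⟩
  2 * n * (n C suc r)    ∎
  where open ≤-Reasoning

-- Rise and fall of the coefficients of (x+1)^N times a sextic.

shift : ∀ {A : Set} → A → ℕ → (ℕ → A) → ℕ → A
shift z zero    f t       = f t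
shift z (suc j) f zero    = z
shift z (suc j) f (suc t) = shift z j f t

-- At t + 1 = j the shifted sequence passes from the padding 0 to `f 0`, so `R` has to relate 0 to
-- every value.
shift-related : ∀ (R : ℕ → ℕ → Set) (f : ℕ → ℕ) t → (∀ y → R 0 y) → (∀ s → s ≤ t → R (f s) (f (suc s))) →
  ∀ j → R (shift 0 j f t) (shift 0 j f (suc t))
shift-related R f t       R0 Rf zero    = Rf t ≤-refl
shift-related R f zero    R0 Rf (suc j) = R0 _
shift-related R f (suc t) R0 Rf (suc j) = shift-related R f t R0 (λ s s≤t → Rf s (m≤n⇒m≤1+n s≤t)) j

∸-mono-<-cross : ∀ {u v u′ v′} → v ≤ u → v′ ≤ u′ → u + v′ < u′ + v → u ∸ v < u′ ∸ v′
∸-mono-<-cross {u} {v} {u′} {v′} v≤u v′≤u′ lt = +-cancelʳ-< (v + v′) _ _ (begin-strict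
  (u ∸ v) + (v + v′)     ≡⟨ sym (+-assoc (u ∸ v) v v′) ⟩
  (u ∸ v) + v + v′       ≡⟨ cong (_+ v′) (m∸n+n≡m v≤u) ⟩
  u + v′                 <⟨ lt ⟩
  u′ + v                 ≡⟨ cong (_+ v) (sym (m∸n+n≡m v′≤u′)) ⟩
  (u′ ∸ v′) + v′ + v     ≡⟨ +-assoc (u′ ∸ v′) v′ v ⟩
  (u′ ∸ v′) + (v′ + v)   ≡⟨ cong ((u′ ∸ v′) +_) (+-comm v′ v) ⟩
  (u′ ∸ v′) + (v + v′)   ∎)
  where open ≤-Reasoning

module Peak (N p₀ p₁ p₂ p₃ p₄ : ℕ) ⦃ _ : NonZero p₁ ⦄ ⦃ _ : NonZero p₄ ⦄ where

  -- The part 2N dominates the terms of opposite sign; the part 8 is a surplus that keeps the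
  -- coefficient below the leading one large.
  p₅ : ℕ
  p₅ = 8 + 2 * N

  -- The coefficient of x^t in x^j (1+x)^N, that is C(N, t-j), and 0 for t < j.
  σ : ℕ → ℕ → ℕ
  σ j = shift 0 j (N C_)

  lin : (ℕ → ℕ) → ℕ
  lin f = p₀ * f 0 + (p₁ * f 1 + (p₂ * f 2 + (p₃ * f 3 + p₄ * f 4)))

  -- The coefficient of x^t is `V t` - `U t`; keeping the two parts apart allows all estimates to be
  -- made in ℕ.
  U V : ℕ → ℕ
  U t = lin (λ j → σ j t) + p₅ * σ 5 t
  V t = σ 6 t

  -- For the ascent: `σ 0` does not increase from t to t + 1 when N = 2t + 1, so strictness is taken
  -- from `σ 1`.
  lin-mono-<₁ : ∀ f g → (∀ j → f j ≤ g j) → f 1 < g 1 → lin f < lin g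
  lin-mono-<₁ f g le lt = +-mono-≤-< (*-monoʳ-≤ p₀ (le 0)) (+-mono-<-≤ (*-monoʳ-< p₁ lt)
    (+-mono-≤ (*-monoʳ-≤ p₂ (le 2)) (+-mono-≤ (*-monoʳ-≤ p₃ (le 3)) (*-monoʳ-≤ p₄ (le 4)))))

  -- For the descent: `σ 5` ties at its first step when N = 2u + 1, so strictness is taken from
  -- `σ 4`.
  lin-mono-<₄ : ∀ {f g} → f 0 ≤ g 0 → f 1 ≤ g 1 → f 2 ≤ g 2 → f 3 ≤ g 3 → f 4 < g 4 → lin f < lin g
  lin-mono-<₄ le₀ le₁ le₂ le₃ lt = +-mono-≤-< (*-monoʳ-≤ p₀ le₀) (+-mono-≤-< (*-monoʳ-≤ p₁ le₁)
    (+-mono-≤-< (*-monoʳ-≤ p₂ le₂) (+-mono-≤-< (*-monoʳ-≤ p₃ le₃) (*-monoʳ-< p₄ lt))))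

  split-p₅ : ∀ x z → p₅ * x + z ≡ 8 * x + (z + 2 * N * x)
  split-p₅ x z = distribute N x z
    where
    distribute : ∀ n x z → (8 + 2 * n) * x + z ≡ 8 * x + (z + 2 * n * x)
    distribute = solve-∀

  p₅-mono : ∀ {x y z w} → x ≤ y → z + 2 * N * x ≤ w + 2 * N * y → p₅ * x + z ≤ p₅ * y + w
  p₅-mono {x} {y} {z} {w} x≤y le = begin
    p₅ * x + z                ≡⟨ split-p₅ x z ⟩
    8 * x + (z + 2 * N * x)   ≤⟨ +-mono-≤ (*-monoʳ-≤ 8 x≤y) le ⟩
    8 * y + (w + 2 * N * y)   ≡⟨ split-p₅ y w ⟨
    p₅ * y + w                ∎
    where open ≤-Reasoning

  -- `U` - `V` grows: `V (suc t)` is `σ 5 t`, which the growth of `p₅ * σ 5` absorbs, while the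
  -- lower terms of `U` increase strictly.
  ascent : ∀ t → t + suc t ≤ N → U t + V (suc t) < U (suc t) + V t
  ascent t t≤ = begin-strict
    U t + V (suc t)
      ≡⟨ +-assoc (lin (λ j → σ j t)) _ _ ⟩
    lin (λ j → σ j t) + (p₅ * σ 5 t + σ 5 t)
      <⟨ +-mono-<-≤ (lin-mono-<₁ (λ j → σ j t) (λ j → σ j (suc t)) (shift-related _≤_ (N C_) t (λ _ → z≤n) rising) (rising₁ t t≤)) (last t t≤) ⟩
    lin (λ j → σ j (suc t)) + p₅ * σ 5 (suc t)
      ≤⟨ m≤m+n (U (suc t)) (V t) ⟩
    U (suc t) + V t ∎
    where
    open ≤-Reasoning
    rising : ∀ s → s ≤ t → N C s ≤ N C suc s
    rising s s≤t = C-increasing (≤-trans (+-mono-≤ s≤t (s≤s s≤t)) t≤)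
    rising₁ : ∀ t → t + suc t ≤ N → σ 1 t < σ 1 (suc t)
    rising₁ zero    _  = s≤s z≤n
    rising₁ (suc t) t≤ = C-increasing-< (<-≤-trans (+-mono-< (n<1+n t) (n<1+n (suc t))) t≤)
    -- For t < 5 the shifted binomial `σ 5 t` is zero; from there on `C-growth` applies at t - 5.
    last : ∀ t → t + suc t ≤ N → p₅ * σ 5 t + σ 5 t ≤ p₅ * σ 5 (suc t)
    last (suc (suc (suc (suc (suc s))))) t≤ = subst (p₅ * (N C s) + N C s ≤_) (+-identityʳ _)
      (p₅-mono {w = 0} (C-increasing (≤-trans (≤-trans (n≤1+n _) (≤-reflexive (sym (+-suc s (suc s))))) s≤)) (C-growth s≤))
      where
      s≤ : s + suc (suc s) ≤ N
      s≤ = ≤-trans (+-mono-≤ (m≤n+m s 5) (m≤n+m (suc (suc s)) 4)) t≤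
    last zero                         _ = ≤-trans (≤-reflexive (trans (+-identityʳ _) (*-zeroʳ p₅))) z≤n
    last (suc zero)                   _ = ≤-trans (≤-reflexive (trans (+-identityʳ _) (*-zeroʳ p₅))) z≤n
    last (suc (suc zero))             _ = ≤-trans (≤-reflexive (trans (+-identityʳ _) (*-zeroʳ p₅))) z≤n
    last (suc (suc (suc zero)))       _ = ≤-trans (≤-reflexive (trans (+-identityʳ _) (*-zeroʳ p₅))) z≤n
    last (suc (suc (suc (suc zero)))) _ = ≤-trans (≤-reflexive (trans (+-identityʳ _) (*-zeroʳ p₅))) z≤n

  -- Here `σ 5` runs from C(N,u) to C(N,u+1), while `V` runs from C(N,u-1) to C(N,u). A fall of
  -- `U - V` could fail only through `V` falling, and `C-three-term` bounds that; for u = 0 the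
  -- earlier value of `V` is 0.
  descent : ∀ u → N ≤ u + suc u → u < N → U (6 + u) + V (5 + u) < U (5 + u) + V (6 + u)
  descent u N≤ u<N = begin-strict
    U (6 + u) + V (5 + u)
      ≡⟨ +-assoc (lin (λ j → σ j (6 + u))) _ _ ⟩
    lin (λ j → σ j (6 + u)) + (p₅ * (N C suc u) + V (5 + u))
      <⟨ +-mono-<-≤ (lin-mono-<₄ {λ j → σ j (6 + u)} {λ j → σ j (5 + u)} (falling 5) (falling 4) (falling 3) (falling 2)
           (C-decreasing-< (<-≤-trans (s≤s N≤) (s≤s (+-monoʳ-≤ u (n≤1+n (suc u))))) u<N))
           (p₅-mono (C-decreasing N≤) (last u N≤ u<N)) ⟩
    lin (λ j → σ j (5 + u)) + (p₅ * (N C u) + N C u)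
      ≡⟨ +-assoc (lin (λ j → σ j (5 + u))) _ _ ⟨
    U (5 + u) + V (6 + u) ∎
    where
    open ≤-Reasoning
    falling : ∀ k → N C suc (k + u) ≤ N C (k + u)
    falling k = C-decreasing (≤-trans N≤ (+-mono-≤ (m≤n+m u k) (s≤s (m≤n+m u k))))
    last : ∀ u → N ≤ u + suc u → u < N → V (5 + u) + 2 * N * (N C suc u) ≤ N C u + 2 * N * (N C u)
    last zero    N≤ u<N = ≤-trans (*-monoʳ-≤ (2 * N) (C-decreasing N≤)) (m≤n+m _ (N C 0))
    last (suc r) N≤ u<N = C-three-term (<⇒≤ u<N) N≤

  -- By `C-pred≤`, the part 2N of `p₅` already pays for `V`, leaving eight copies of `σ 5`.
  V+8σ₅≤U : ∀ t → t ≤ 5 + N → V t + 8 * σ 5 t ≤ U t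
  V+8σ₅≤U t t≤ = begin
    V t + 8 * σ 5 t         ≤⟨ +-monoˡ-≤ _ (bound t t≤) ⟩
    2 * N * σ 5 t + 8 * σ 5 t ≡⟨ distribute N (σ 5 t) ⟩
    p₅ * σ 5 t              ≤⟨ m≤n+m _ (lin (λ j → σ j t)) ⟩
    U t                     ∎
    where
    open ≤-Reasoning
    distribute : ∀ n x → 2 * n * x + 8 * x ≡ (8 + 2 * n) * x
    distribute = solve-∀
    bound : ∀ t → t ≤ 5 + N → V t ≤ 2 * N * σ 5 t
    bound zero                               _ = z≤n
    bound (suc zero)                         _ = z≤n
    bound (suc (suc zero))                   _ = z≤n
    bound (suc (suc (suc zero)))             _ = z≤n
    bound (suc (suc (suc (suc zero))))       _ = z≤n
    bound (suc (suc (suc (suc (suc zero))))) _ = z≤n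
    bound (suc (suc (suc (suc (suc (suc r)))))) (s≤s (s≤s (s≤s (s≤s (s≤s sr≤N))))) = C-pred≤ sr≤N

  V≤U : ∀ t → t ≤ 5 + N → V t ≤ U t
  V≤U t t≤ = ≤-trans (m≤m+n _ _) (V+8σ₅≤U t t≤)

  module _ {a : ℕ → ℤ} (a≡ : ∀ t → a t ≡ V t ⊖ U t) where

    ∣a∣ : ∀ t → t ≤ 5 + N → ℤ.∣ a t ∣ ≡ U t ∸ V t
    ∣a∣ t t≤ = trans (cong ℤ.∣_∣ (a≡ t)) (ℤ.∣⊖∣-≤ (V≤U t t≤))

    -- A smaller t satisfies 2t + 1 ≤ N, and then the next coefficient is strictly larger in
    -- absolute value.
    peak-≥ : ∀ t → AttainsMaxAbs a (6 + N) t → ⌊ suc N /2⌋ ≤ t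
    peak-≥ t (_ , max) = ≮⇒≥ λ t< →
      let 2t≤ : suc t + suc t ≤ suc N
          2t≤ = ≤-trans (+-mono-≤ t< (≤-trans t< (⌊n/2⌋≤⌈n/2⌉ (suc N)))) (≤-reflexive (⌊n/2⌋+⌈n/2⌉≡n (suc N)))
          t≤ : t + suc t ≤ N
          t≤ = ≤-pred 2t≤
          st≤N : suc t ≤ N
          st≤N = ≤-trans (m≤n+m (suc t) t) t≤
          st≤ : suc t ≤ 5 + N
          st≤ = ≤-trans st≤N (m≤n+m N 5)
          lt : ℤ.∣ a t ∣ < ℤ.∣ a (suc t) ∣
          lt = subst₂ _<_ (sym (∣a∣ t (<⇒≤ st≤))) (sym (∣a∣ (suc t) st≤))
                 (∸-mono-<-cross (V≤U t (<⇒≤ st≤)) (V≤U (suc t) st≤) (ascent t t≤))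
      in <⇒≱ lt (max (suc t) (m≤n⇒m≤1+n st≤))

    -- At the leading coefficient `U` is 0 and `V` is 1, so the formula `∣a∣` stops one place
    -- earlier. The coefficient before it is at least 8 in absolute value.
    top-small : ℤ.∣ a (6 + N) ∣ < ℤ.∣ a (5 + N) ∣
    top-small = begin-strict
      ℤ.∣ a (6 + N) ∣             ≡⟨ cong ℤ.∣_∣ (trans (a≡ (6 + N)) (cong₂ _⊖_ (nCn≡1 N) U≡0)) ⟩
      1                           <⟨ s≤s (s≤s z≤n) ⟩
      8                           ≡⟨ cong (8 *_) (nCn≡1 N) ⟨
      8 * σ 5 (5 + N)             ≡⟨ m+n∸m≡n (V (5 + N)) _ ⟨
      V (5 + N) + 8 * σ 5 (5 + N) ∸ V (5 + N) ≤⟨ ∸-monoˡ-≤ (V (5 + N)) (V+8σ₅≤U (5 + N) ≤-refl) ⟩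
      U (5 + N) ∸ V (5 + N)       ≡⟨ ∣a∣ (5 + N) ≤-refl ⟨
      ℤ.∣ a (5 + N) ∣             ∎
      where
      open ≤-Reasoning
      vanish : ∀ k → N C (suc k + N) ≡ 0
      vanish k = k>n⇒nCk≡0 (s≤s (m≤n+m N k))
      U≡0 : U (6 + N) ≡ 0
      U≡0 rewrite vanish 5 | vanish 4 | vanish 3 | vanish 2 | vanish 1 | vanish 0
                | *-zeroʳ p₀ | *-zeroʳ p₁ | *-zeroʳ p₂ | *-zeroʳ p₃ | *-zeroʳ p₄ | *-zeroʳ p₅ = refl

    peak-≤ : ∀ t → AttainsMaxAbs a (6 + N) t → t ≤ 5 + ⌊ N /2⌋
    peak-≤ t (t≤ , max) = ≮⇒≥ (beyond t t≤ max)
      where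
      beyond : ∀ t → t ≤ 6 + N → (∀ k → k ≤ 6 + N → ℤ.∣ a k ∣ ≤ ℤ.∣ a t ∣) → 5 + ⌊ N /2⌋ < t → _
      -- Here t = 6 + u with ⌊N/2⌋ ≤ u. The case u = N is the leading coefficient; otherwise the
      -- coefficient just before is strictly larger in absolute value.
      beyond (suc (suc (suc (suc (suc (suc u)))))) (s≤s (s≤s (s≤s (s≤s (s≤s (s≤s u≤N)))))) max (s≤s (s≤s (s≤s (s≤s (s≤s (s≤s half≤u)))))) with m≤n⇒m<n∨m≡n u≤N
      ... | inj₂ refl = <⇒≱ top-small (max (5 + N) (n≤1+n _))
      ... | inj₁ u<N  = <⇒≱ (subst₂ _<_ (sym (∣a∣ (6 + u) (+-monoʳ-≤ 5 u<N))) (sym (∣a∣ (5 + u) (+-monoʳ-≤ 5 u≤N)))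
                          (∸-mono-<-cross (V≤U (6 + u) (+-monoʳ-≤ 5 u<N)) (V≤U (5 + u) (+-monoʳ-≤ 5 u≤N)) (descent u N≤ u<N)))
                          (max (5 + u) (+-mono-≤ (n≤1+n 5) u≤N))
        where
        ⌈n/2⌉≤1+⌊n/2⌋ : ∀ n → ⌈ n /2⌉ ≤ suc ⌊ n /2⌋
        ⌈n/2⌉≤1+⌊n/2⌋ zero          = z≤n
        ⌈n/2⌉≤1+⌊n/2⌋ (suc zero)    = s≤s z≤n
        ⌈n/2⌉≤1+⌊n/2⌋ (suc (suc n)) = s≤s (⌈n/2⌉≤1+⌊n/2⌋ n)
        N≤ : N ≤ u + suc u
        N≤ = ≤-trans (≤-reflexive (sym (⌊n/2⌋+⌈n/2⌉≡n N))) (+-mono-≤ half≤u (≤-trans (⌈n/2⌉≤1+⌊n/2⌋ N) (s≤s half≤u)))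

open import Data.Fin.Subset using (Subset; _∈_; _⊆_; _∪_; ⁅_⁆; ∣_∣; ⊥)
open import Data.Fin.Subset.Properties using (_∈?_; p⊆q⇒∣p∣≤∣q∣; ∣p∣≤∣p∪q∣; ∣⁅x⁆∣≡1; ∣⊥∣≡0; x∈⁅x⁆; x∈p∪q⁺; ∪-comm; ∪-idem; ∪-identityˡ; ∪-identityʳ)
open import Data.Integer.Base using (+_; -_)
open import Data.Integer.Tactic.RingSolver using () renaming (solve-∀ to solveℤ-∀)
open import Data.List.Base using (List; []; _∷_; map)
open import Data.List.Properties using (≡-dec)
open import Data.Unit.Base using (tt)
open import Data.Vec.Base using (Vec; []; _∷_; _++_; lookup; here; there)
open import Data.Vec.Properties using (zipWith-++)
open import Relation.Binary.Construct.Closure.ReflexiveTransitive using (Star; ε; _◅_; _◅◅_; reverse)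

-- The ring of polynomials

open RawRing polyRawRing using (_≈_)

coeff-+ : ∀ p q k → coeff (p +ₚ q) k ≡ coeff p k ℤ.+ coeff q k
coeff-+ []      q       k       = sym (ℤ.+-identityˡ _)
coeff-+ (a ∷ p) []      k       = sym (ℤ.+-identityʳ _)
coeff-+ (a ∷ p) (b ∷ q) zero    = refl
coeff-+ (a ∷ p) (b ∷ q) (suc k) = coeff-+ p q k

coeff-neg : ∀ p k → coeff (-ₚ p) k ≡ ℤ.- coeff p k
coeff-neg []      k       = refl
coeff-neg (a ∷ p) zero    = refl
coeff-neg (a ∷ p) (suc k) = coeff-neg p k

coeff-scale : ∀ a p k → coeff (map (a ℤ.*_) p) k ≡ a ℤ.* coeff p k
coeff-scale a []      k       = sym (ℤ.*-zeroʳ a)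
coeff-scale a (b ∷ p) zero    = refl
coeff-scale a (b ∷ p) (suc k) = coeff-scale a p k

coeff-*-zero : ∀ a p q → coeff ((a ∷ p) *ₚ q) 0 ≡ a ℤ.* coeff q 0
coeff-*-zero a p q = trans (coeff-+ (map (a ℤ.*_) q) _ 0) (trans (ℤ.+-identityʳ _) (coeff-scale a q 0))

coeff-*-suc : ∀ a p q k → coeff ((a ∷ p) *ₚ q) (suc k) ≡ a ℤ.* coeff q (suc k) ℤ.+ coeff (p *ₚ q) k
coeff-*-suc a p q k = trans (coeff-+ (map (a ℤ.*_) q) _ (suc k)) (cong (ℤ._+ coeff (p *ₚ q) k) (coeff-scale a q (suc k)))

*ₚ-congˡ : ∀ p {q r} → q ≈ r → p *ₚ q ≈ p *ₚ r
*ₚ-congˡ []      q≈r k = refl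
*ₚ-congˡ (a ∷ p) {q} {r} q≈r zero    = trans (coeff-*-zero a p q) (trans (cong (a ℤ.*_) (q≈r 0)) (sym (coeff-*-zero a p r)))
*ₚ-congˡ (a ∷ p) {q} {r} q≈r (suc k) = trans (coeff-*-suc a p q k)
  (trans (cong₂ (λ x y → a ℤ.* x ℤ.+ y) (q≈r (suc k)) (*ₚ-congˡ p {q} {r} q≈r k)) (sym (coeff-*-suc a p r k)))

*ₚ-zeroʳ : ∀ p → p *ₚ [] ≈ []
*ₚ-zeroʳ []      k       = refl
*ₚ-zeroʳ (a ∷ p) zero    = refl
*ₚ-zeroʳ (a ∷ p) (suc k) = *ₚ-zeroʳ p k

-- Multiplication is defined by recursion on the first factor; this is the same recursion on the
-- second, which makes commutativity a direct induction.
*ₚ-∷ : ∀ p b q → p *ₚ (b ∷ q) ≈ map (b ℤ.*_) p +ₚ (0ℤ ∷ (p *ₚ q))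
*ₚ-∷ []      b q zero    = refl
*ₚ-∷ []      b q (suc k) = refl
*ₚ-∷ (a ∷ p) b q zero    = trans (coeff-*-zero a p (b ∷ q)) (trans (ℤ.*-comm a b) (sym (ℤ.+-identityʳ _)))
*ₚ-∷ (a ∷ p) b q (suc k) = trans (coeff-*-suc a p (b ∷ q) k)
  (trans (cong (λ x → a ℤ.* coeff q k ℤ.+ x) (*ₚ-∷ p b q k))
  (trans shuffle
  (sym (coeff-+ (map (b ℤ.*_) p) ((a ∷ p) *ₚ q) k))))
  where
  swap : ∀ x y z → x ℤ.+ (y ℤ.+ z) ≡ y ℤ.+ (x ℤ.+ z)
  swap = solveℤ-∀
  shuffle : a ℤ.* coeff q k ℤ.+ coeff (map (b ℤ.*_) p +ₚ (0ℤ ∷ (p *ₚ q))) k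
          ≡ coeff (map (b ℤ.*_) p) k ℤ.+ coeff ((a ∷ p) *ₚ q) k
  shuffle = trans (cong (λ x → a ℤ.* coeff q k ℤ.+ x) (coeff-+ (map (b ℤ.*_) p) _ k))
    (trans (swap (a ℤ.* coeff q k) (coeff (map (b ℤ.*_) p) k) _)
    (cong (λ x → coeff (map (b ℤ.*_) p) k ℤ.+ x)
      (trans (cong (ℤ._+ coeff (0ℤ ∷ (p *ₚ q)) k) (sym (coeff-scale a q k))) (sym (coeff-+ (map (a ℤ.*_) q) _ k)))))

*ₚ-comm : ∀ p q → p *ₚ q ≈ q *ₚ p
*ₚ-comm []      q k = sym (*ₚ-zeroʳ q k)
*ₚ-comm (a ∷ p) q k = trans (coeff-+ (map (a ℤ.*_) q) _ k)
  (trans (cong (λ x → coeff (map (a ℤ.*_) q) k ℤ.+ x) (tail k))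
  (sym (trans (*ₚ-∷ q a p k) (coeff-+ (map (a ℤ.*_) q) _ k))))
  where
  tail : 0ℤ ∷ (p *ₚ q) ≈ 0ℤ ∷ (q *ₚ p)
  tail zero    = refl
  tail (suc k) = *ₚ-comm p q k

*ₚ-congʳ : ∀ p {q r} → q ≈ r → q *ₚ p ≈ r *ₚ p
*ₚ-congʳ p {q} {r} q≈r k = trans (*ₚ-comm q p k) (trans (*ₚ-congˡ p {q} {r} q≈r k) (*ₚ-comm p r k))

*ₚ-distribˡ : ∀ p q r → p *ₚ (q +ₚ r) ≈ p *ₚ q +ₚ p *ₚ r
*ₚ-distribˡ []      q r k       = refl
*ₚ-distribˡ (a ∷ p) q r zero    = trans (coeff-*-zero a p (q +ₚ r))
  (trans (cong (a ℤ.*_) (coeff-+ q r 0)) (trans (ℤ.*-distribˡ-+ a (coeff q 0) (coeff r 0))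
  (sym (trans (coeff-+ ((a ∷ p) *ₚ q) _ 0) (cong₂ ℤ._+_ (coeff-*-zero a p q) (coeff-*-zero a p r))))))
*ₚ-distribˡ (a ∷ p) q r (suc k) = trans (coeff-*-suc a p (q +ₚ r) k)
  (trans (cong₂ (λ x y → a ℤ.* x ℤ.+ y) (coeff-+ q r (suc k)) (trans (*ₚ-distribˡ p q r k) (coeff-+ (p *ₚ q) _ k)))
  (trans (rearrange a (coeff q (suc k)) (coeff r (suc k)) (coeff (p *ₚ q) k) (coeff (p *ₚ r) k))
  (sym (trans (coeff-+ ((a ∷ p) *ₚ q) _ (suc k)) (cong₂ ℤ._+_ (coeff-*-suc a p q k) (coeff-*-suc a p r k))))))
  where
  rearrange : ∀ a x y u v → a ℤ.* (x ℤ.+ y) ℤ.+ (u ℤ.+ v) ≡ (a ℤ.* x ℤ.+ u) ℤ.+ (a ℤ.* y ℤ.+ v)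
  rearrange = solveℤ-∀

*ₚ-distribʳ : ∀ p q r → (q +ₚ r) *ₚ p ≈ q *ₚ p +ₚ r *ₚ p
*ₚ-distribʳ p q r k = trans (*ₚ-comm (q +ₚ r) p k) (trans (*ₚ-distribˡ p q r k)
  (trans (coeff-+ (p *ₚ q) _ k) (trans (cong₂ ℤ._+_ (*ₚ-comm p q k) (*ₚ-comm p r k)) (sym (coeff-+ (q *ₚ p) _ k)))))

*ₚ-scaleˡ : ∀ a p q → map (a ℤ.*_) p *ₚ q ≈ map (a ℤ.*_) (p *ₚ q)
*ₚ-scaleˡ a []      q k       = refl
*ₚ-scaleˡ a (b ∷ p) q zero    = trans (coeff-*-zero (a ℤ.* b) (map (a ℤ.*_) p) q) (trans (ℤ.*-assoc a b (coeff q 0))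
  (sym (trans (coeff-scale a ((b ∷ p) *ₚ q) 0) (cong (a ℤ.*_) (coeff-*-zero b p q)))))
*ₚ-scaleˡ a (b ∷ p) q (suc k) = trans (coeff-*-suc (a ℤ.* b) (map (a ℤ.*_) p) q k)
  (trans (cong (λ x → a ℤ.* b ℤ.* coeff q (suc k) ℤ.+ x) (trans (*ₚ-scaleˡ a p q k) (coeff-scale a (p *ₚ q) k)))
  (trans (factor a b (coeff q (suc k)) (coeff (p *ₚ q) k))
  (sym (trans (coeff-scale a ((b ∷ p) *ₚ q) (suc k)) (cong (a ℤ.*_) (coeff-*-suc b p q k))))))
  where
  factor : ∀ a b x y → a ℤ.* b ℤ.* x ℤ.+ a ℤ.* y ≡ a ℤ.* (b ℤ.* x ℤ.+ y)
  factor = solveℤ-∀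

*ₚ-assoc : ∀ p q r → (p *ₚ q) *ₚ r ≈ p *ₚ (q *ₚ r)
*ₚ-assoc []      q r k = refl
*ₚ-assoc (a ∷ p) q r k = trans (*ₚ-distribʳ r (map (a ℤ.*_) q) (0ℤ ∷ (p *ₚ q)) k)
  (trans (coeff-+ (map (a ℤ.*_) q *ₚ r) _ k)
  (trans (cong₂ ℤ._+_ (*ₚ-scaleˡ a q r k) (tail k))
  (sym (coeff-+ (map (a ℤ.*_) (q *ₚ r)) _ k))))
  where
  tail : (0ℤ ∷ (p *ₚ q)) *ₚ r ≈ 0ℤ ∷ (p *ₚ (q *ₚ r))
  tail zero    = coeff-*-zero 0ℤ (p *ₚ q) r
  tail (suc k) = trans (coeff-*-suc 0ℤ (p *ₚ q) r k) (trans (ℤ.+-identityˡ _) (*ₚ-assoc p q r k))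

*ₚ-identityˡ : ∀ p → (1ℤ ∷ []) *ₚ p ≈ p
*ₚ-identityˡ p zero    = trans (coeff-*-zero 1ℤ [] p) (ℤ.*-identityˡ _)
*ₚ-identityˡ p (suc k) = trans (coeff-*-suc 1ℤ [] p k) (trans (ℤ.+-identityʳ _) (ℤ.*-identityˡ _))

-- It has the operations of `polyRawRing`, so the results on determinants apply to `charpoly`.
polyRing : CommutativeRing 0ℓ 0ℓ
polyRing = record
  { RawRing polyRawRing
  ; isCommutativeRing = record
    { isRing = record
      { +-isAbelianGroup = record
        { isGroup = record
          { isMonoid = record
            { isSemigroup = record
              { isMagma = record
                { isEquivalence = record
                  { refl  = λ k → refl
                  ; sym   = λ p≈q k → sym (p≈q k)
                  ; trans = λ p≈q q≈r k → trans (p≈q k) (q≈r k)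
                  }
                ; ∙-cong = λ {p} {q} {r} {s} p≈q r≈s k → trans (coeff-+ p r k) (trans (cong₂ ℤ._+_ (p≈q k) (r≈s k)) (sym (coeff-+ q s k)))
                }
              ; assoc = λ p q r k → trans (coeff-+ (p +ₚ q) r k) (trans (cong (ℤ._+ coeff r k) (coeff-+ p q k))
                  (trans (ℤ.+-assoc (coeff p k) (coeff q k) (coeff r k))
                  (sym (trans (coeff-+ p (q +ₚ r) k) (cong (λ x → coeff p k ℤ.+ x) (coeff-+ q r k))))))
              }
            ; identity = (λ p k → refl) , (λ p k → trans (coeff-+ p [] k) (ℤ.+-identityʳ _))
            }
          ; inverse = (λ p k → trans (coeff-+ (-ₚ p) p k) (trans (cong (ℤ._+ coeff p k) (coeff-neg p k)) (ℤ.+-inverseˡ (coeff p k))))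
                    , (λ p k → trans (coeff-+ p (-ₚ p) k) (trans (cong (λ x → coeff p k ℤ.+ x) (coeff-neg p k)) (ℤ.+-inverseʳ (coeff p k))))
          ; ⁻¹-cong = λ {p} {q} p≈q k → trans (coeff-neg p k) (trans (cong ℤ.-_ (p≈q k)) (sym (coeff-neg q k)))
          }
        ; comm = λ p q k → trans (coeff-+ p q k) (trans (ℤ.+-comm (coeff p k) (coeff q k)) (sym (coeff-+ q p k)))
        }
      ; *-cong     = λ {p} {q} {r} {s} p≈q r≈s k → trans (*ₚ-congˡ p {r} {s} r≈s k) (*ₚ-congʳ s {p} {q} p≈q k)
      ; *-assoc    = *ₚ-assoc
      ; *-identity = *ₚ-identityˡ , (λ p k → trans (*ₚ-comm p (1ℤ ∷ []) k) (*ₚ-identityˡ p k))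
      ; distrib    = *ₚ-distribˡ , *ₚ-distribʳ
      }
    ; *-comm = *ₚ-comm
    }
  }

open import Algebra.Definitions.RawSemiring (RawRing.rawSemiring polyRawRing) using (_^_) renaming (_×_ to _·_)

coeff-· : ∀ n p k → coeff (n · p) k ≡ + n ℤ.* coeff p k
coeff-· zero    p k = sym (ℤ.*-zeroˡ (coeff p k))
coeff-· (suc n) p k = trans (coeff-+ p (n · p) k) (trans (cong (λ x → coeff p k ℤ.+ x) (coeff-· n p k))
  (sym (ℤ.suc-* (+ n) (coeff p k))))

1+x : Poly
1+x = 1ℤ ∷ 1ℤ ∷ []

coeff-[1+x]^ : ∀ n k → coeff (1+x ^ n) k ≡ + (n C k)
coeff-[1+x]^ zero    zero    = refl
coeff-[1+x]^ zero    (suc k) = refl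
coeff-[1+x]^ (suc n) zero    = trans (coeff-*-zero 1ℤ (1ℤ ∷ []) (1+x ^ n)) (trans (ℤ.*-identityˡ _) (coeff-[1+x]^ n 0))
coeff-[1+x]^ (suc n) (suc k) = trans (coeff-*-suc 1ℤ (1ℤ ∷ []) (1+x ^ n) k)
  (trans (cong₂ ℤ._+_ (trans (ℤ.*-identityˡ _) (coeff-[1+x]^ n (suc k))) (trans (*ₚ-identityˡ (1+x ^ n) k) (coeff-[1+x]^ n k)))
  (trans (ℤ.+-comm (+ (n C suc k)) (+ (n C k))) (cong +_ (nCk+nC[k+1]≡[n+1]C[k+1] n k))))

hits : ∀ {n} → Subset n → Bool
hits []      = false
hits (b ∷ p) = b ∨ hits p

-- Edges of the minimal subtree; only correct if the set has at least two elements.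
hullEdges : ∀ {q} → Subset (3 + q) → Subset (2 + q)
hullEdges (b₀ ∷ b₁ ∷ b₂ ∷ l) = b₀ ∷ ((b₀ ∨ b₁) ∧ (b₂ ∨ hits l)) ∷ l

-- Steiner distances in S_{1,q}

zero∈⁺ : ∀ {n b} {p : Subset n} → b ≡ true → zero ∈ b ∷ p
zero∈⁺ refl = here

zero∈⁻ : ∀ {n b} {p : Subset n} → zero ∈ b ∷ p → b ≡ true
zero∈⁻ here = refl

suc∈⁻ : ∀ {n b} {p : Subset n} {i} → suc i ∈ b ∷ p → i ∈ p
suc∈⁻ (there i∈p) = i∈p

∨-introʳ : ∀ a {b} → b ≡ true → a ∨ b ≡ true
∨-introʳ false refl = refl
∨-introʳ true  refl = refl

∨-introˡ : ∀ {a} b → a ≡ true → a ∨ b ≡ true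
∨-introˡ b refl = refl

∧-intro : ∀ {a b} → a ≡ true → b ≡ true → a ∧ b ≡ true
∧-intro refl refl = refl

∨-elim : ∀ a {b} → a ∨ b ≡ true → a ≡ true ⊎ b ≡ true
∨-elim false b≡ = inj₂ b≡
∨-elim true  _  = inj₁ refl

∧-elim : ∀ a {b} → a ∧ b ≡ true → a ≡ true × b ≡ true
∧-elim true b≡ = refl , b≡

hits⁺ : ∀ {n} {p : Subset n} {i} → i ∈ p → hits p ≡ true
hits⁺ here                  = refl
hits⁺ {p = b ∷ _} (there i∈) = ∨-introʳ b (hits⁺ i∈)

hits⁻ : ∀ {n} (p : Subset n) → hits p ≡ true → ∃ λ i → i ∈ p
hits⁻ (true  ∷ p) _ = zero , here
hits⁻ (false ∷ p) h = let i , i∈ = hits⁻ p h in suc i , there i∈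

another-element : ∀ {n} (p : Subset n) → 2 ≤ ∣ p ∣ → ∀ u → ∃ λ w → w ∈ p × w ≢ u
another-element p 2≤∣p∣ u with any? (λ w → (w ∈? p) ×-dec ¬? (w ≟ᶠ u))
... | yes found = found
... | no ¬found = contradiction (ℕ.≤-trans 2≤∣p∣ (subst (∣ p ∣ ≤_) (∣⁅x⁆∣≡1 u) (p⊆q⇒∣p∣≤∣q∣ p⊆u))) λ { (s≤s ()) }
  where
  p⊆u : p ⊆ ⁅ u ⁆
  p⊆u {w} w∈p with w ≟ᶠ u
  ... | yes refl = x∈⁅x⁆ u
  ... | no  w≢u  = ⊥-elim (¬found (w , w∈p , w≢u))

-- An element of p that is a leaf of the tree brings its only neighbour with it.
hullVertices : ∀ {q} → Subset (3 + q) → Subset (3 + q)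
hullVertices (b₀ ∷ b₁ ∷ b₂ ∷ l) = b₀ ∷ (b₀ ∨ b₁) ∷ (b₂ ∨ hits l) ∷ l

module _ {q : ℕ} where

  ⊆-hullVertices : (p : Subset (3 + q)) → p ⊆ hullVertices p
  ⊆-hullVertices (b₀ ∷ b₁ ∷ b₂ ∷ l) {v₀}                v∈ = zero∈⁺ (zero∈⁻ v∈)
  ⊆-hullVertices (b₀ ∷ b₁ ∷ b₂ ∷ l) {v₁}                v∈ = there (zero∈⁺ (∨-introʳ b₀ (zero∈⁻ (suc∈⁻ v∈))))
  ⊆-hullVertices (b₀ ∷ b₁ ∷ b₂ ∷ l) {v₂}                v∈ = there (there (zero∈⁺ (∨-introˡ (hits l) (zero∈⁻ (suc∈⁻ (suc∈⁻ v∈))))))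
  ⊆-hullVertices (b₀ ∷ b₁ ∷ b₂ ∷ l) {suc (suc (suc i))} v∈ = there (there (there (suc∈⁻ (suc∈⁻ (suc∈⁻ v∈)))))

  Adjacent-sym : ∀ E {u v} → Adjacent (S-graph q) E u v → Adjacent (S-graph q) E v u
  Adjacent-sym E {u} {v} (e , e∈E , eq) = e , e∈E , trans eq (∪-comm ⁅ u ⁆ ⁅ v ⁆)

  hull-isSubgraph : (p : Subset (3 + q)) → IsSubgraph (S-graph q) (hullVertices p) (hullEdges p)
  hull-isSubgraph (b₀ ∷ b₁ ∷ b₂ ∷ l) zero e∈ v∈ with ∈-pair⁻ v₀ v₁ v∈
  ... | inj₁ refl = zero∈⁺ (zero∈⁻ e∈)
  ... | inj₂ refl = there (zero∈⁺ (∨-introˡ b₁ (zero∈⁻ e∈)))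
  hull-isSubgraph (b₀ ∷ b₁ ∷ b₂ ∷ l) (suc zero) e∈ v∈ with ∈-pair⁻ v₁ v₂ v∈ | ∧-elim (b₀ ∨ b₁) (zero∈⁻ (suc∈⁻ e∈))
  ... | inj₁ refl | l≡ , _ = there (zero∈⁺ l≡)
  ... | inj₂ refl | _ , r≡ = there (there (zero∈⁺ r≡))
  hull-isSubgraph (b₀ ∷ b₁ ∷ b₂ ∷ l) (suc (suc i)) e∈ v∈ with ∈-pair⁻ v₂ (suc (suc (suc i))) v∈
  ... | inj₁ refl = there (there (zero∈⁺ (∨-introʳ b₂ (hits⁺ (suc∈⁻ (suc∈⁻ e∈))))))
  ... | inj₂ refl = there (there (there (suc∈⁻ (suc∈⁻ e∈))))

  hull-isConnected : (p : Subset (3 + q)) → IsConnected (S-graph q) (hullVertices p) (hullEdges p)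
  hull-isConnected p@(b₀ ∷ b₁ ∷ b₂ ∷ l) u v u∈ v∈ = proj₂ root u u∈ ◅◅ reverse (Adjacent-sym E) (proj₂ root v v∈)
    where
    E : Subset (2 + q)
    E = hullEdges p
    -- If p meets the far side, `v₂` lies in the hull and is reached from everywhere. Otherwise the
    -- hull lies within `v₀` and `v₁`, and `v₁` serves.
    root : ∃ λ r → ∀ u → u ∈ hullVertices p → Star (Adjacent (S-graph q) E) u r
    root with b₂ ∨ hits l in eq
    ... | true  = v₂ , toRoot
      where
      E′ : Subset (2 + q)
      E′ = b₀ ∷ ((b₀ ∨ b₁) ∧ true) ∷ l
      step₁ : b₀ ∨ b₁ ≡ true → Adjacent (S-graph q) E′ v₁ v₂
      step₁ l≡ = v₁ , there (zero∈⁺ (∧-intro l≡ refl)) , refl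
      toRoot : ∀ u → u ∈ b₀ ∷ (b₀ ∨ b₁) ∷ true ∷ l → Star (Adjacent (S-graph q) E′) u v₂
      toRoot v₀ u∈ = _◅_ {j = v₁} (v₀ , zero∈⁺ (zero∈⁻ u∈) , refl) (step₁ (∨-introˡ b₁ (zero∈⁻ u∈)) ◅ ε)
      toRoot v₁ u∈ = step₁ (zero∈⁻ (suc∈⁻ u∈)) ◅ ε
      toRoot v₂ u∈ = ε
      toRoot (suc (suc (suc i))) u∈ = Adjacent-sym E′ {v₂} {suc (suc (suc i))} (suc (suc i) , there (there (suc∈⁻ (suc∈⁻ (suc∈⁻ u∈)))) , refl) ◅ ε
    ... | false = v₁ , toRoot
      where
      E′ : Subset (2 + q)
      E′ = b₀ ∷ ((b₀ ∨ b₁) ∧ false) ∷ l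
      toRoot : ∀ u → u ∈ b₀ ∷ (b₀ ∨ b₁) ∷ false ∷ l → Star (Adjacent (S-graph q) E′) u v₁
      toRoot v₀ u∈ = (v₀ , zero∈⁺ (zero∈⁻ u∈) , refl) ◅ ε
      toRoot v₁ u∈ = ε
      toRoot v₂ u∈ = contradiction (zero∈⁻ (suc∈⁻ (suc∈⁻ u∈))) λ ()
      toRoot (suc (suc (suc i))) u∈ = contradiction (trans (sym eq) (∨-introʳ b₂ (hits⁺ (suc∈⁻ (suc∈⁻ (suc∈⁻ u∈)))))) λ ()

  -- A walk from `x` to another vertex has a first edge, and only one edge is incident to `x`.
  pendant-edge : ∀ {E x w} e → (∀ e′ y → set (S-edge q e′) ≡ ⁅ x ⁆ ∪ ⁅ y ⁆ → e′ ≡ e) →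
    Star (Adjacent (S-graph q) E) x w → w ≢ x → e ∈ E
  pendant-edge e only ε w≢x = contradiction refl w≢x
  pendant-edge {E} e only (_◅_ {j = y} (e′ , e′∈E , eq) _) w≢x = subst (_∈ E) (only e′ y eq) e′∈E

  only-e₁ : ∀ e y → set (S-edge q e) ≡ ⁅ v₀ ⁆ ∪ ⁅ y ⁆ → e ≡ zero
  only-e₁ zero          y eq = refl
  only-e₁ (suc zero)    y eq with pair-injective v₁ v₂ v₀ y (λ ()) eq
  ... | inj₁ (() , _)
  ... | inj₂ (() , _)
  only-e₁ (suc (suc i)) y eq with pair-injective v₂ (suc (suc (suc i))) v₀ y (λ ()) eq
  ... | inj₁ (() , _)
  ... | inj₂ (() , _)

  only-leaf : ∀ i e y → set (S-edge q e) ≡ ⁅ suc (suc (suc i)) ⁆ ∪ ⁅ y ⁆ → e ≡ suc (suc i)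
  only-leaf i zero          y eq with pair-injective v₀ v₁ (suc (suc (suc i))) y (λ ()) eq
  ... | inj₁ (() , _)
  ... | inj₂ (() , _)
  only-leaf i (suc zero)    y eq with pair-injective v₁ v₂ (suc (suc (suc i))) y (λ ()) eq
  ... | inj₁ (() , _)
  ... | inj₂ (() , _)
  only-leaf i (suc (suc j)) y eq with pair-injective v₂ (suc (suc (suc j))) (suc (suc (suc i))) y (λ ()) eq
  ... | inj₂ (refl , _) = refl

  near : Fin (3 + q) → Bool
  near v₀          = true
  near v₁          = true
  near (suc (suc _)) = false

  -- Every edge other than the one between `v₁` and `v₂` keeps a walk on the side where it started.
  crossing-edge : ∀ {E u w} → near u ≡ true → near w ≡ false → Star (Adjacent (S-graph q) E) u w → suc zero ∈ E
  crossing-edge nu nw ε = contradiction (trans (sym nu) nw) λ ()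
  crossing-edge {u = u} nu nw (_◅_ {j = y} (zero , e∈ , eq) rest) with pair-injective v₀ v₁ u y (λ ()) eq
  ... | inj₁ (_ , refl) = crossing-edge refl nw rest
  ... | inj₂ (_ , refl) = crossing-edge refl nw rest
  crossing-edge nu nw ((suc zero , e∈ , eq) ◅ rest) = e∈
  crossing-edge {u = u} nu nw (_◅_ {j = y} (suc (suc i) , e∈ , eq) rest) with pair-injective v₂ (suc (suc (suc i))) u y (λ ()) eq
  ... | inj₁ (refl , _) = contradiction nu λ ()
  ... | inj₂ (refl , _) = contradiction nu λ ()

  -- Minimality of the hull. A second element of p provides a walk out of each leaf, which needs the
  -- pendant edge; elements on both sides provide a walk across the middle edge.
  hullEdges-⊆ : (p : Subset (3 + q)) → 2 ≤ ∣ p ∣ → ∀ {V E} → IsConnected (S-graph q) V E → p ⊆ V → hullEdges p ⊆ E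
  hullEdges-⊆ p@(b₀ ∷ b₁ ∷ b₂ ∷ l) 2≤ {V} {E} conn p⊆V {e} = go e
    where
    pendant : ∀ {x} → x ∈ p → ∀ e → (∀ e′ y → set (S-edge q e′) ≡ ⁅ x ⁆ ∪ ⁅ y ⁆ → e′ ≡ e) → e ∈ E
    pendant {x} x∈p e only with another-element p 2≤ x
    ... | w , w∈p , w≢x = pendant-edge e only (conn x w (p⊆V x∈p) (p⊆V w∈p)) w≢x
    nearElement : b₀ ∨ b₁ ≡ true → ∃ λ u → u ∈ p × near u ≡ true
    nearElement eq with ∨-elim b₀ eq
    ... | inj₁ b₀≡ = v₀ , zero∈⁺ b₀≡ , refl
    ... | inj₂ b₁≡ = v₁ , there (zero∈⁺ b₁≡) , refl
    farElement : b₂ ∨ hits l ≡ true → ∃ λ u → u ∈ p × near u ≡ false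
    farElement eq with ∨-elim b₂ eq
    ... | inj₁ b₂≡ = v₂ , there (there (zero∈⁺ b₂≡)) , refl
    ... | inj₂ l≡  = let i , i∈l = hits⁻ l l≡ in suc (suc (suc i)) , there (there (there i∈l)) , refl
    go : ∀ e → e ∈ hullEdges p → e ∈ E
    go zero e∈ = pendant (zero∈⁺ (zero∈⁻ e∈)) zero only-e₁
    go (suc zero) e∈ with ∧-elim (b₀ ∨ b₁) (zero∈⁻ (suc∈⁻ e∈))
    ... | l≡ , r≡ with nearElement l≡ | farElement r≡
    ...   | u , u∈ , nu | w , w∈ , nw = crossing-edge nu nw (conn u w (p⊆V u∈) (p⊆V w∈))
    go (suc (suc i)) e∈ = pendant (there (there (there (suc∈⁻ (suc∈⁻ e∈))))) (suc (suc i)) (only-leaf i)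

  steinerDistance-hull : (p : Subset (3 + q)) → 2 ≤ ∣ p ∣ → steinerDistance (S₁ q) p ≡ ∣ hullEdges p ∣
  steinerDistance-hull p 2≤ with steiner (S₁ q) p
  ... | d , (V , E , (_ , conn) , p⊆V , refl) , least = ℕ.≤-antisym
    (least _ (hullVertices p , hullEdges p , (hull-isSubgraph p , hull-isConnected p) , ⊆-hullVertices p , refl))
    (p⊆q⇒∣p∣≤∣q∣ (hullEdges-⊆ p 2≤ conn p⊆V))

  𝔇₂-hull : (a b : V₂ (3 + q)) → 𝔇₂ (S₁ q) a b ≡ + ∣ hullEdges (set a ∪ set b) ∣
  𝔇₂-hull a b = cong +_ (steinerDistance-hull (set a ∪ set b)
    (subst (_≤ ∣ set a ∪ set b ∣) (card a) (∣p∣≤∣p∪q∣ (set a) (set b))))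

-- A row of H is the trace of an element of B on v₀, v₁, v₂ and the s leaves
-- that play a special role; the last row stands for all the other leaf edges,
-- whose own leaf is counted by tailCount.
module Template {s h : ℕ} (H : Vec (Subset (3 + s)) (suc h)) where

  tailCount : Fin (suc h) → ℕ
  tailCount a = if does (a ≟ᶠ fromℕ h) then 1 else 0

  distance : Fin (suc h) → Fin (suc h) → ℕ
  distance a b = ∣ hullEdges (lookup H a ∪ lookup H b) ∣ + (tailCount a + tailCount b)

  x : Poly
  x = 0ℤ ∷ 1ℤ ∷ []

  offDiagonal : SquareMatrix Poly (suc h)
  offDiagonal a b = -ₚ (+ distance a b ∷ [])

  -- `distance` at the last template index counts two distinct leaves, but a leaf edge paired with
  -- itself has only one. The true diagonal entry is one smaller, hence `1+x` in place of `x`.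
  onDiagonal : Fin (suc h) → Poly
  onDiagonal a = if does (a ≟ᶠ fromℕ h) then 1+x else x

  open Determinants.Clamped polyRing h offDiagonal onDiagonal public

H₁ : Vec (Subset 4) 6
H₁ = (⁅ v₀ ⁆ ∪ ⁅ v₂ ⁆) ∷ (⁅ v₁ ⁆ ∪ ⁅ v₃ ⁆) ∷ (⁅ v₀ ⁆ ∪ ⁅ v₁ ⁆) ∷ (⁅ v₁ ⁆ ∪ ⁅ v₂ ⁆) ∷ (⁅ v₂ ⁆ ∪ ⁅ v₃ ⁆) ∷ ⁅ v₂ ⁆ ∷ []

H₂ : Vec (Subset 5) 7
H₂ = (⁅ v₀ ⁆ ∪ ⁅ v₂ ⁆) ∷ (⁅ v₃ ⁆ ∪ ⁅ v₄ ⁆) ∷ (⁅ v₀ ⁆ ∪ ⁅ v₁ ⁆) ∷ (⁅ v₁ ⁆ ∪ ⁅ v₂ ⁆) ∷ (⁅ v₂ ⁆ ∪ ⁅ v₃ ⁆) ∷ (⁅ v₂ ⁆ ∪ ⁅ v₄ ⁆) ∷ ⁅ v₂ ⁆ ∷ []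

∣++∣ : ∀ {n m} (p : Subset n) (q : Subset m) → ∣ p ++ q ∣ ≡ ∣ p ∣ + ∣ q ∣
∣++∣ []          q = refl
∣++∣ (true  ∷ p) q = cong suc (∣++∣ p q)
∣++∣ (false ∷ p) q = ∣++∣ p q

hits-++ : ∀ {n m} (p : Subset n) (q : Subset m) → hits (p ++ q) ≡ hits p ∨ hits q
hits-++ []      q = refl
hits-++ (b ∷ p) q = trans (cong (b ∨_) (hits-++ p q)) (sym (∨-assoc b (hits p) (hits q)))

hits-⊥ : ∀ n → hits (⊥ {n}) ≡ false
hits-⊥ zero    = refl
hits-⊥ (suc n) = hits-⊥ n

-- Each further leaf costs its own edge. The hypothesis ensures that these leaves do not change
-- whether the set meets the far side, so the middle edge is unaffected.
hull-++ : ∀ {s m} (p : Subset (3 + s)) (l : Subset m) → v₂ ∈ p ⊎ hits l ≡ false →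
  ∣ hullEdges (p ++ l) ∣ ≡ ∣ hullEdges p ∣ + ∣ l ∣
hull-++ p@(b₀ ∷ b₁ ∷ b₂ ∷ k) l hyp = trans (cong (λ c → ∣ b₀ ∷ ((b₀ ∨ b₁) ∧ c) ∷ (k ++ l) ∣) (far hyp)) (∣++∣ (hullEdges p) l)
  where
  far : v₂ ∈ p ⊎ hits l ≡ false → b₂ ∨ hits (k ++ l) ≡ b₂ ∨ hits k
  far (inj₁ v₂∈p) rewrite zero∈⁻ (suc∈⁻ (suc∈⁻ v₂∈p)) = refl
  far (inj₂ l≡)   = cong (b₂ ∨_) (trans (hits-++ k l) (trans (cong (hits k ∨_) l≡) (∨-identityʳ _)))

-- The information lost by `clamp`: which ordinary leaf, if any, belongs to the index.
tailLeaf : ∀ h {m} → Fin (h + m) → Subset m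
tailLeaf zero    i       = ⁅ i ⁆
tailLeaf (suc h) zero    = ⊥
tailLeaf (suc h) (suc i) = tailLeaf h i

tailLeaf-↑ˡ : ∀ {h m} (a : Fin h) → tailLeaf h (a ↑ˡ m) ≡ ⊥
tailLeaf-↑ˡ zero    = refl
tailLeaf-↑ˡ (suc a) = tailLeaf-↑ˡ a

tailLeaf-↑ʳ : ∀ h {m} (k : Fin m) → tailLeaf h (h ↑ʳ k) ≡ ⁅ k ⁆
tailLeaf-↑ʳ zero    k = refl
tailLeaf-↑ʳ (suc h) k = tailLeaf-↑ʳ h k

clamp-↑ˡ : ∀ {h m} (a : Fin h) → clamp h (a ↑ˡ m) ≡ inject₁ a
clamp-↑ˡ zero    = refl
clamp-↑ˡ (suc a) = cong suc (clamp-↑ˡ a)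

clamp-↑ʳ : ∀ h {m} (k : Fin m) → clamp h (h ↑ʳ k) ≡ fromℕ h
clamp-↑ʳ zero    k = refl
clamp-↑ʳ (suc h) k = cong suc (clamp-↑ʳ h k)

data SplitView h {m} : Fin (h + m) → Set where
  head : (a : Fin h) → SplitView h (a ↑ˡ m)
  tail : (k : Fin m) → SplitView h (h ↑ʳ k)

splitView : ∀ h {m} (i : Fin (h + m)) → SplitView h i
splitView zero    i       = tail i
splitView (suc h) zero    = head zero
splitView (suc h) (suc i) with splitView h i
... | head a = head (suc a)
... | tail k = tail k

-- From Steiner distances to clamped matrices.

module Entries {s h : ℕ} (H : Vec (Subset (3 + s)) (suc h)) (v₂∈H : v₂ ∈ lookup H (fromℕ h)) where

  open Template {s} {h} H using (tailCount; x; onDiagonal; clamped; bordered; det-clamped; det-clamped-factor)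

  tailCount-inject₁ : ∀ a → tailCount (inject₁ a) ≡ 0
  tailCount-inject₁ a rewrite dec-false (inject₁ a ≟ᶠ fromℕ h) (fromℕ≢inject₁ ∘ sym) = refl

  tailCount-fromℕ : tailCount (fromℕ h) ≡ 1
  tailCount-fromℕ rewrite dec-true (fromℕ h ≟ᶠ fromℕ h) refl = refl

  onDiagonal-inject₁ : ∀ a → onDiagonal (inject₁ a) ≡ x
  onDiagonal-inject₁ a rewrite dec-false (inject₁ a ≟ᶠ fromℕ h) (fromℕ≢inject₁ ∘ sym) = refl

  onDiagonal-fromℕ : onDiagonal (fromℕ h) ≡ 1+x
  onDiagonal-fromℕ rewrite dec-true (fromℕ h ≟ᶠ fromℕ h) refl = refl

  module _ {m : ℕ} (B : Fin (h + m) → V₂ (3 + (s + m))) (set-B : ∀ i → set (B i) ≡ lookup H (clamp h i) ++ tailLeaf h i) where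

    ∣leaves∣ : ∀ i j → i ≢ j → ∣ tailLeaf h i ∪ tailLeaf h {m} j ∣ ≡ tailCount (clamp h i) + tailCount (clamp h j)
    ∣leaves∣ i j i≢j with splitView h i | splitView h j
    ... | head a | head b rewrite tailLeaf-↑ˡ {m = m} a | tailLeaf-↑ˡ {m = m} b | clamp-↑ˡ {m = m} a | clamp-↑ˡ {m = m} b
                                | tailCount-inject₁ a | tailCount-inject₁ b = trans (cong ∣_∣ (∪-idem (⊥ {m}))) (∣⊥∣≡0 m)
    ... | head a | tail l rewrite tailLeaf-↑ˡ {m = m} a | tailLeaf-↑ʳ h l | clamp-↑ˡ {m = m} a | clamp-↑ʳ h l
                                | tailCount-inject₁ a | tailCount-fromℕ = trans (cong ∣_∣ (∪-identityˡ ⁅ l ⁆)) (∣⁅x⁆∣≡1 l)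
    ... | tail k | head b rewrite tailLeaf-↑ʳ h k | tailLeaf-↑ˡ {m = m} b | clamp-↑ʳ h k | clamp-↑ˡ {m = m} b
                                | tailCount-inject₁ b | tailCount-fromℕ = trans (cong ∣_∣ (∪-identityʳ ⁅ k ⁆)) (∣⁅x⁆∣≡1 k)
    ... | tail k | tail l rewrite tailLeaf-↑ʳ h k | tailLeaf-↑ʳ h l | clamp-↑ʳ h k | clamp-↑ʳ h l
                                | tailCount-fromℕ = ∣⁅i⁆∪⁅j⁆∣≡2 k l (λ { refl → i≢j refl })

    far-or-leafless : ∀ i j → v₂ ∈ lookup H (clamp h i) ∪ lookup H (clamp h j) ⊎ hits (tailLeaf h i ∪ tailLeaf h {m} j) ≡ false
    far-or-leafless i j with splitView h i | splitView h j
    ... | tail k | _      rewrite clamp-↑ʳ h k = inj₁ (x∈p∪q⁺ (inj₁ v₂∈H))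
    ... | head _ | tail l rewrite clamp-↑ʳ h l = inj₁ (x∈p∪q⁺ (inj₂ v₂∈H))
    ... | head a | head b rewrite tailLeaf-↑ˡ {m = m} a | tailLeaf-↑ˡ {m = m} b = inj₂ (trans (cong hits (∪-idem (⊥ {m}))) (hits-⊥ m))

    𝔇₂-entry : ∀ i j → 𝔇₂ (S₁ (s + m)) (B i) (B j)
      ≡ + (∣ hullEdges (lookup H (clamp h i) ∪ lookup H (clamp h j)) ∣ + ∣ tailLeaf h i ∪ tailLeaf h {m} j ∣)
    𝔇₂-entry i j = trans (𝔇₂-hull (B i) (B j)) (cong +_ (trans
      (cong (∣_∣ ∘ hullEdges) (trans (cong₂ _∪_ (set-B i) (set-B j)) (zipWith-++ _∨_ (lookup H (clamp h i)) _ (lookup H (clamp h j)) _)))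
      (hull-++ (lookup H (clamp h i) ∪ lookup H (clamp h j)) _ (far-or-leafless i j))))

    entry : ∀ i j → (if does (i ≟ᶠ j) then x else []) +ₚ (-ₚ (𝔇₂ (S₁ (s + m)) (B i) (B j) ∷ [])) ≈ clamped (h + m) i j
    entry i j with i ≟ᶠ j
    ... | no i≢j rewrite 𝔇₂-entry i j | ∣leaves∣ i j i≢j = λ k → refl
    ... | yes refl with splitView h i
    ...   | head a rewrite 𝔇₂-entry (a ↑ˡ m) (a ↑ˡ m) | tailLeaf-↑ˡ {m = m} a | clamp-↑ˡ {m = m} a
                         | tailCount-inject₁ a | onDiagonal-inject₁ a | ∪-idem (⊥ {m}) | ∣⊥∣≡0 m =
      CommutativeRing.+-comm polyRing x (-ₚ (+ (∣ hullEdges (lookup H (inject₁ a) ∪ lookup H (inject₁ a)) ∣ + 0) ∷ []))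
    -- The union of a leaf with itself has one element where the template counts two; the constant
    -- term of `1+x` makes up the difference.
    ...   | tail k rewrite 𝔇₂-entry (h ↑ʳ k) (h ↑ʳ k) | tailLeaf-↑ʳ h k | clamp-↑ʳ h k
                         | tailCount-fromℕ | onDiagonal-fromℕ | ∪-idem ⁅ k ⁆ | ∣⁅x⁆∣≡1 k =
      λ k → cong (λ c → coeff (c ∷ 1ℤ ∷ []) k) (tail-entry (∣ hullEdges (lookup H (fromℕ h) ∪ lookup H (fromℕ h)) ∣))
      where
      move : ∀ a → 0ℤ ℤ.+ ℤ.- (a ℤ.+ + 1) ≡ ℤ.- (a ℤ.+ + 2) ℤ.+ 1ℤ
      move = solveℤ-∀
      tail-entry : ∀ n → 0ℤ ℤ.+ ℤ.- (+ (n + 1)) ≡ ℤ.- (+ (n + 2)) ℤ.+ 1ℤ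
      tail-entry n = move (+ n)

  -- Comparing the determinant with p inside a decision procedure makes its
  -- evaluation a single reduction with sharing; comparing by refl is infeasible.
  Evaluates : ∀ {n} → SquareMatrix Poly n → Poly → Set
  Evaluates M p = True (≡-dec ℤ._≟_ (det polyRawRing M) p)

  evaluates : ∀ {n} (M : SquareMatrix Poly n) {p} → Evaluates M p → det polyRawRing M ≡ p
  evaluates M {p} = toWitness {a? = ≡-dec ℤ._≟_ (det polyRawRing M) p}

  -- The sizes q and K are indices, so that the lemmas below apply to B₁ and B₂
  -- with the sizes exactly as they are written in the types of these functions.
  data Enumerates (m : ℕ) : ∀ {q K} → (Fin K → V₂ (3 + q)) → Set where
    enumerates : (B : Fin (h + m) → V₂ (3 + (s + m))) → (∀ i → set (B i) ≡ lookup H (clamp h i) ++ tailLeaf h i) → Enumerates m B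

  charpoly-clamped : ∀ {m q K} {B : Fin K → V₂ (3 + q)} → Enumerates m B → ∀ {n} → h + m ≡ n →
    charpoly (principal (𝔇₂ (S₁ q)) B) ≈ det polyRawRing (clamped n)
  charpoly-clamped {m} (enumerates B set-B) refl = Determinants.det-cong polyRing _ (clamped (h + m)) (entry B set-B)

  module _ {m q K : ℕ} {B : Fin K → V₂ (3 + q)} (enum : Enumerates m B) where

    charpoly-zero : ∀ {A} → Evaluates (clamped h) A → m ≡ 0 → charpoly (principal (𝔇₂ (S₁ q)) B) ≈ A
    charpoly-zero ev m≡0 t = trans (charpoly-clamped enum (trans (cong (h ℕ.+_) m≡0) (+-identityʳ h)) t)
      (cong (λ p → coeff p t) (evaluates (clamped h) ev))

    charpoly-suc : ∀ {A F} → Evaluates (clamped h) A → Evaluates (bordered h) F → ∀ {k} → m ≡ suc k →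
      charpoly (principal (𝔇₂ (S₁ q)) B) ≈ (1+x *ₚ A +ₚ suc k · F) *ₚ (1+x ^ k)
    charpoly-suc evA evF {k} m≡ t = trans (charpoly-clamped enum (trans (cong (h ℕ.+_) m≡) (+-comm h (suc k))) t)
      (trans (det-clamped k t)
      (cong₂ (λ y (A , F) → coeff ((y *ₚ A +ₚ suc k · F) *ₚ (y ^ k)) t) onDiagonal-fromℕ
        (cong₂ _,_ (evaluates (clamped h) evA) (evaluates (bordered h) evF))))

    charpoly-factor : ∀ {A f} → Evaluates (clamped h) A → Evaluates (bordered h) (1+x *ₚ f) →
      charpoly (principal (𝔇₂ (S₁ q)) B) ≈ (A +ₚ m · f) *ₚ (1+x ^ m)
    charpoly-factor {A} {f} evA evF t = trans (charpoly-clamped enum (+-comm h m) t)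
      (trans (det-clamped-factor {f} (λ k → cong (λ p → coeff p k) (trans (evaluates (bordered h) evF) (cong (_*ₚ f) (sym onDiagonal-fromℕ)))) m t)
      (cong₂ (λ y A → coeff ((A +ₚ m · f) *ₚ (y ^ m)) t) onDiagonal-fromℕ (evaluates (clamped h) evA)))

-- The sets of `B₁` and `B₂` in terms of their templates.

set-B₁ : ∀ m i → set (B₁ m i) ≡ lookup H₁ (clamp 5 i) ++ tailLeaf 5 i
set-B₁ m v₀ = cong (lookup H₁ v₀ ++_) (∪-idem ⊥)
set-B₁ m v₁ = cong (lookup H₁ v₁ ++_) (∪-idem ⊥)
set-B₁ m v₂ = cong (lookup H₁ v₂ ++_) (∪-idem ⊥)
set-B₁ m v₃ = cong (lookup H₁ v₃ ++_) (∪-idem ⊥)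
set-B₁ m v₄ = cong (lookup H₁ v₄ ++_) (∪-idem ⊥)
set-B₁ m (suc (suc (suc (suc (suc i))))) = cong (⁅ v₂ ⁆ ++_) (∪-identityˡ ⁅ i ⁆)

set-B₂ : ∀ m i → set (B₂ m i) ≡ lookup H₂ (clamp 6 i) ++ tailLeaf 6 i
set-B₂ m v₀ = cong (lookup H₂ v₀ ++_) (∪-idem ⊥)
set-B₂ m v₁ = cong (lookup H₂ v₁ ++_) (∪-idem ⊥)
set-B₂ m v₂ = cong (lookup H₂ v₂ ++_) (∪-idem ⊥)
set-B₂ m v₃ = cong (lookup H₂ v₃ ++_) (∪-idem ⊥)
set-B₂ m v₄ = cong (lookup H₂ v₄ ++_) (∪-idem ⊥)
set-B₂ m (suc (suc (suc (suc (suc zero)))))    = cong (lookup H₂ (suc v₄) ++_) (∪-idem ⊥)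
set-B₂ m (suc (suc (suc (suc (suc (suc i)))))) = cong (⁅ v₂ ⁆ ++_) (∪-identityˡ ⁅ i ⁆)

-- Explicit characteristic polynomials and their coefficients.

pencil : ℕ → List (ℕ × ℕ) → Poly
pencil n []            = 1ℤ ∷ []
pencil n ((α , β) ∷ l) = - + (α + n * β) ∷ pencil n l

-- The constant part of the pencil and the factor of n: closed polynomials with which the evaluated
-- determinants can be matched.
pencil₀ pencil₁ : List (ℕ × ℕ) → Poly
pencil₀ []            = 1ℤ ∷ []
pencil₀ ((α , β) ∷ l) = - + α ∷ pencil₀ l
pencil₁ []            = []
pencil₁ ((α , β) ∷ l) = - + β ∷ pencil₁ l

pencil₀+n·pencil₁ : ∀ n l → pencil₀ l +ₚ n · pencil₁ l ≈ pencil n l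
pencil₀+n·pencil₁ n l k = trans (coeff-+ (pencil₀ l) (n · pencil₁ l) k)
  (trans (cong (λ c → coeff (pencil₀ l) k ℤ.+ c) (coeff-· n (pencil₁ l) k)) (pointwise l k))
  where
  combine : ∀ a n b → - a ℤ.+ n ℤ.* (- b) ≡ - (a ℤ.+ n ℤ.* b)
  combine = solveℤ-∀
  pointwise : ∀ l k → coeff (pencil₀ l) k ℤ.+ + n ℤ.* coeff (pencil₁ l) k ≡ coeff (pencil n l) k
  pointwise []            k       = trans (cong (λ c → coeff (1ℤ ∷ []) k ℤ.+ c) (ℤ.*-zeroʳ (+ n))) (ℤ.+-identityʳ _)
  pointwise ((α , β) ∷ l) zero    = trans (combine (+ α) (+ n) (+ β)) (cong (λ c → - (+ α ℤ.+ c)) (sym (ℤ.pos-* n β)))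
  pointwise ((α , β) ∷ l) (suc k) = pointwise l k

shift-coeff-[] : ∀ j t → shift 0ℤ j (coeff []) t ≡ 0ℤ
shift-coeff-[] zero    t       = refl
shift-coeff-[] (suc j) zero    = refl
shift-coeff-[] (suc j) (suc t) = shift-coeff-[] j t

shift-coeff-∷ : ∀ N a p j t → shift 0ℤ j (coeff ((a ∷ p) *ₚ (1+x ^ N))) t
  ≡ a ℤ.* + shift 0 j (N C_) t ℤ.+ shift 0ℤ (suc j) (coeff (p *ₚ (1+x ^ N))) t
shift-coeff-∷ N a p zero    zero    = trans (coeff-*-zero a p (1+x ^ N)) (trans (cong (a ℤ.*_) (coeff-[1+x]^ N 0)) (sym (ℤ.+-identityʳ _)))
shift-coeff-∷ N a p zero    (suc t) = trans (coeff-*-suc a p (1+x ^ N) t) (cong (λ c → a ℤ.* c ℤ.+ coeff (p *ₚ (1+x ^ N)) t) (coeff-[1+x]^ N (suc t)))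
shift-coeff-∷ N a p (suc j) zero    = sym (trans (ℤ.+-identityʳ _) (ℤ.*-zeroʳ a))
shift-coeff-∷ N a p (suc j) (suc t) = shift-coeff-∷ N a p j t

combination : ℕ → Poly → ℕ → ℕ → ℤ
combination N []      j t = 0ℤ
combination N (a ∷ p) j t = a ℤ.* + shift 0 j (N C_) t ℤ.+ combination N p (suc j) t

-- Each coefficient of `p` that is split off raises the shift by one, so the induction needs an
-- arbitrary `j`.
shift-coeff : ∀ N p j t → shift 0ℤ j (coeff (p *ₚ (1+x ^ N))) t ≡ combination N p j t
shift-coeff N []      j t = shift-coeff-[] j t
shift-coeff N (a ∷ p) j t = trans (shift-coeff-∷ N a p j t)
  (cong (λ c → a ℤ.* + shift 0 j (N C_) t ℤ.+ c) (shift-coeff N p (suc j) t))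

module _ (N p₀ p₁ p₂ p₃ p₄ : ℕ) ⦃ _ : NonZero p₁ ⦄ ⦃ _ : NonZero p₄ ⦄ where
  open Peak N p₀ p₁ p₂ p₃ p₄

  peakFactor : Poly
  peakFactor = - + p₀ ∷ - + p₁ ∷ - + p₂ ∷ - + p₃ ∷ - + p₄ ∷ - + p₅ ∷ 1ℤ ∷ []

  coeff-peak : ∀ t → coeff (peakFactor *ₚ (1+x ^ N)) t ≡ V t ⊖ U t
  coeff-peak t = trans (shift-coeff N peakFactor 0 t) (trans
    (arrange (+ p₀) (+ p₁) (+ p₂) (+ p₃) (+ p₄) (+ p₅) (+ σ 0 t) (+ σ 1 t) (+ σ 2 t) (+ σ 3 t) (+ σ 4 t) (+ σ 5 t) (+ σ 6 t))
    (trans (cong (λ c → + V t ℤ.- c) (sym embed)) (ℤ.m-n≡m⊖n (V t) (U t))))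
    where
    arrange : ∀ a b c d e f s₀ s₁ s₂ s₃ s₄ s₅ s₆ →
      (- a) ℤ.* s₀ ℤ.+ ((- b) ℤ.* s₁ ℤ.+ ((- c) ℤ.* s₂ ℤ.+ ((- d) ℤ.* s₃ ℤ.+ ((- e) ℤ.* s₄ ℤ.+ ((- f) ℤ.* s₅ ℤ.+ (1ℤ ℤ.* s₆ ℤ.+ 0ℤ))))))
      ≡ s₆ ℤ.- (a ℤ.* s₀ ℤ.+ (b ℤ.* s₁ ℤ.+ (c ℤ.* s₂ ℤ.+ (d ℤ.* s₃ ℤ.+ e ℤ.* s₄))) ℤ.+ f ℤ.* s₅)
    arrange = solveℤ-∀
    embed : + U t ≡ + p₀ ℤ.* + σ 0 t ℤ.+ (+ p₁ ℤ.* + σ 1 t ℤ.+ (+ p₂ ℤ.* + σ 2 t ℤ.+ (+ p₃ ℤ.* + σ 3 t ℤ.+ + p₄ ℤ.* + σ 4 t))) ℤ.+ + p₅ ℤ.* + σ 5 t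
    embed = cong₂ ℤ._+_ (cong₂ ℤ._+_ (ℤ.pos-* p₀ (σ 0 t)) (cong₂ ℤ._+_ (ℤ.pos-* p₁ (σ 1 t)) (cong₂ ℤ._+_ (ℤ.pos-* p₂ (σ 2 t))
      (cong₂ ℤ._+_ (ℤ.pos-* p₃ (σ 3 t)) (ℤ.pos-* p₄ (σ 4 t)))))) (ℤ.pos-* p₅ (σ 5 t))

  peak-bounds : ∀ (a : ℕ → ℤ) {c} → c ≡ p₅ →
    (∀ t → a t ≡ coeff ((- + p₀ ∷ - + p₁ ∷ - + p₂ ∷ - + p₃ ∷ - + p₄ ∷ - + c ∷ 1ℤ ∷ []) *ₚ (1+x ^ N)) t) →
    ∀ t → AttainsMaxAbs a (5 + N + 1) t → ⌊ suc N /2⌋ ≤ t × t ≤ ⌈ 5 + N + 4 /2⌉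
  -- After the commutations the degree reads 6 + N, and the upper bound computes to 5 + ⌊N/2⌋.
  peak-bounds a refl a≡ t max rewrite +-comm N 1 | +-comm N 4 = peak-≥ {a} a≡′ t max , peak-≤ {a} a≡′ t max
    where
    a≡′ : ∀ t → a t ≡ V t ⊖ U t
    a≡′ t = trans (a≡ t) (coeff-peak t)

-- Constant terms first. In `weights₁` the first components come from (1+x) times `smallest₁` and
-- the second from the bordered determinant. In `weights₂` they come from the clamped determinant
-- and from the bordered one divided by 1+x.
weights₁ weights₂ : List (ℕ × ℕ)
weights₁ = (3 , 1) ∷ (24 , 13) ∷ (70 , 45) ∷ (90 , 54) ∷ (48 , 21) ∷ (6 , 2) ∷ []
weights₂ = (4 , 1) ∷ (41 , 15) ∷ (132 , 53) ∷ (169 , 62) ∷ (83 , 21) ∷ (8 , 2) ∷ []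

smallest₁ : Poly
smallest₁ = - + 3 ∷ - + 21 ∷ - + 49 ∷ - + 41 ∷ - + 7 ∷ 1ℤ ∷ []

module E₁ = Entries {1} {5} H₁ (there (there here))
module E₂ = Entries {2} {6} H₂ (there (there here))

B₁-enumerates : ∀ m → E₁.Enumerates m {1 + m} (B₁ m)
B₁-enumerates m = E₁.enumerates (B₁ m) (set-B₁ m)

B₂-enumerates : ∀ m → E₂.Enumerates m {2 + m} (B₂ m)
B₂-enumerates m = E₂.enumerates (B₂ m) (set-B₂ m)

charpoly₁-zero : ∀ {m} → m ≡ 0 → charpoly (principal (𝔇₂ (S₁ (1 + m))) (B₁ m)) ≈ smallest₁
charpoly₁-zero {m} = E₁.charpoly-zero (B₁-enumerates m) {smallest₁} tt

-- The bordered determinant is not divisible by 1+x here (its value at -1 is 2), so the exponent is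
-- m - 1 and m = 0 is treated apart.
charpoly₁-suc : ∀ {m N} → m ≡ suc N → charpoly (principal (𝔇₂ (S₁ (1 + m))) (B₁ m)) ≈ pencil (suc N) weights₁ *ₚ (1+x ^ N)
charpoly₁-suc {m} {N} m≡ t = trans (E₁.charpoly-suc (B₁-enumerates m) {smallest₁} {pencil₁ weights₁} tt tt m≡ t)
  (*ₚ-congʳ (1+x ^ N) {pencil₀ weights₁ +ₚ suc N · pencil₁ weights₁} {pencil (suc N) weights₁} (pencil₀+n·pencil₁ (suc N) weights₁) t)

-- The columns of the leaf edges at `v₃` and `v₄` differ only by x+1 and -(x+1) in their own two
-- rows, also in the bordered matrix. So its determinant is divisible by 1+x, and one formula covers
-- every m.
charpoly₂ : ∀ m → charpoly (principal (𝔇₂ (S₁ (2 + m))) (B₂ m)) ≈ pencil m weights₂ *ₚ (1+x ^ m)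
charpoly₂ m t = trans (E₂.charpoly-factor (B₂-enumerates m) {pencil₀ weights₂} {pencil₁ weights₂} tt tt t)
  (*ₚ-congʳ (1+x ^ m) {pencil₀ weights₂ +ₚ m · pencil₁ weights₂} {pencil m weights₂} (pencil₀+n·pencil₁ m weights₂) t)

-- The sequence is a variable, so that the case split on `m` leaves the characteristic polynomial
-- folded.
bounds₁ : ∀ (a : ℕ → ℤ) m → (m ≡ 0 → ∀ t → a t ≡ coeff smallest₁ t) →
  (∀ {N} → m ≡ suc N → ∀ t → a t ≡ coeff (pencil (suc N) weights₁ *ₚ (1+x ^ N)) t) →
  ∀ t → AttainsMaxAbs a (4 + m + 1) t → ⌊ m /2⌋ ≤ t × t ≤ ⌈ 4 + m + 4 /2⌉
-- For n = 4 only t = 5 has to be excluded: the leading coefficient is 1, the one before it -7.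
bounds₁ a zero    a≡ _  t (t≤5 , max) = z≤n , ≤-pred (≤∧≢⇒< t≤5 λ { refl →
  contradiction (subst₂ _≤_ (cong ℤ.∣_∣ (a≡ refl 4)) (cong ℤ.∣_∣ (a≡ refl 5)) (max 4 (n≤1+n 4))) λ { (s≤s ()) } })
-- The pencil is taken at N + 1, and 6 + 2(N + 1) is the required 8 + 2N.
bounds₁ a (suc N) _  a≡ = peak-bounds N (3 + suc N * 1) (24 + suc N * 13) (70 + suc N * 45) (90 + suc N * 54) (48 + suc N * 21)
  a (last N) (a≡ refl)
  where
  last : ∀ N → 6 + suc N * 2 ≡ 8 + 2 * N
  last = solve-∀

bounds₂ : ∀ (b : ℕ → ℤ) m → (∀ t → b t ≡ coeff (pencil m weights₂ *ₚ (1+x ^ m)) t) →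
  ∀ t → AttainsMaxAbs b (5 + m + 1) t → ⌊ suc m /2⌋ ≤ t × t ≤ ⌈ 5 + m + 4 /2⌉
bounds₂ b m b≡ = peak-bounds m (4 + m * 1) (41 + m * 15) (132 + m * 53) (169 + m * 62) (83 + m * 21)
  b (cong (λ c → 8 + c) (*-comm m 2)) b≡

theorem5p6 :
    ((m : ℕ) →
      let n = 4 + m
          a = coeff (charpoly (principal (𝔇₂ (S₁ (1 + m))) (B₁ m)))
      in (t : ℕ) → AttainsMaxAbs a (n + 1) t →
         ⌊ n ∸ 4 /2⌋ ≤ t × t ≤ ⌈ n + 4 /2⌉)
    ×
    ((m : ℕ) →
      let n = 5 + m
          b = coeff (charpoly (principal (𝔇₂ (S₁ (2 + m))) (B₂ m)))
      in (t : ℕ) → AttainsMaxAbs b (n + 1) t →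
         ⌊ n ∸ 4 /2⌋ ≤ t × t ≤ ⌈ n + 4 /2⌉)
theorem5p6 =
  (λ m → bounds₁ (coeff (charpoly (principal (𝔇₂ (S₁ (1 + m))) (B₁ m)))) m charpoly₁-zero charpoly₁-suc) ,
  (λ m → bounds₂ (coeff (charpoly (principal (𝔇₂ (S₁ (2 + m))) (B₂ m)))) m (charpoly₂ m))
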